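{- Let $p=3$. There is a well-defined homeomorphism $$\Psi:3\mathbb{Z}_3\cup(1+3\mathbb{Z}_3)\longrightarrow U^{(1)}-U^{(2)}$$ given by $\Psi(0)=q_0$, $\Psi(1)=q_1$, and, for $z\in \big(3\mathbb{Z}_3\cup(1+3\mathbb{Z}_3)\big)-\{0,1\}$, $\Psi(z)=q$, where $q\in U^{(1)}-U^{(2)}$ is the unique element such that $\iota_q(z)=z$.
   Context: $\mathbb{Z}_3$ is the ring of $3$-adic integers, $U^{(m)}=1+3^m\mathbb{Z}_3$, and all sets carry the subspace topology from $\mathbb{Z}_3$. For $q\in U^{(1)}$, $\iota_q:\mathbb{Z}_3\to\mathbb{Z}_3$ is the unique continuous function with $\iota_q(n)=1+q+\cdots+q^{n-1}$ for all integers $n\ge 0$; thus $\iota_q(z)=(q^z-1)/(q-1)$ for $q\ne 1$. A $3$-adic fixed point is $z\in\mathbb{Z}_3$ with $\iota_q(z)=z$; the fixed points $0,1$ are called trivial. $q_0$ and $q_1$ denote the unique elements of $U^{(1)}-U^{(2)}$ with $q_0\equiv 7\pmod 9$ and $q_1\equiv 4\pmod 9$ such that $\iota_{q_0}$ and $\iota_{q_1}$ have no nontrivial $3$-adic fixed points (their existence and uniqueness is a result of the same paper). -}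

module Defs where

open import Algebra.Bundles using (CommutativeRing)
open import Algebra.Structures using (IsCommutativeRing)
import Algebra.Properties.Semiring.Exp as Exp
open import Data.Integer.Base as ℤ using (ℤ; +_; -[1+_])
import Data.Integer.DivMod as ℤ
open import Data.Integer.Divisibility.Signed as ℤ using (_∣_; divides)
import Data.Integer.Properties as ℤ
open import Data.Integer.Tactic.RingSolver using (solve-∀)
open import Data.Nat.Base as ℕ using (ℕ; zero; suc)
import Data.Nat.Properties as ℕ
open import Data.Product using (∃; _×_; _,_; proj₁; proj₂; ∃-syntax)
open import Data.Sum.Base using (inj₁; inj₂)
open import Function.Base using (_∘_)
open import Function.Bundles using (Inverse)
open import Level using (0ℓ)
open import Relation.Binary.Bundles using (Setoid)
import Relation.Binary.Construct.On as On
open import Relation.Binary.PropositionalEquality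
  using (_≡_; refl; sym; trans; cong; cong₂; subst; module ≡-Reasoning)
open import Relation.Nullary using (¬_)
open import Relation.Unary using (Pred; _∈_; _∪_; _∖_; U)

3^ : ℕ → ℤ
3^ n = + (3 ℕ.^ n)

infix 4 _≡_[mod_]

record _≡_[mod_] (a b m : ℤ) : Set where
  constructor mk≡
  field
    difference : m ∣ a ℤ.- b

open _≡_[mod_] public

module _ {m : ℤ} where

  mod-by : ∀ {a b x} → m ∣ x → x ≡ a ℤ.- b → a ≡ b [mod m ]
  mod-by d refl = mk≡ d

  ≡⇒≡mod : ∀ {a b} → a ≡ b → a ≡ b [mod m ]
  ≡⇒≡mod {a} refl = mk≡ (divides (+ 0) (ℤ.+-inverseʳ a))

  mod-refl : ∀ {a} → a ≡ a [mod m ]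
  mod-refl = ≡⇒≡mod refl

  mod-sym : ∀ {a b} → a ≡ b [mod m ] → b ≡ a [mod m ]
  mod-sym {a} {b} (mk≡ p) = mod-by (ℤ.∣m⇒∣-m p) (eq a b)
    where
    eq : ∀ a b → ℤ.- (a ℤ.- b) ≡ b ℤ.- a
    eq = solve-∀

  mod-trans : ∀ {a b c} → a ≡ b [mod m ] → b ≡ c [mod m ] → a ≡ c [mod m ]
  mod-trans {a} {b} {c} (mk≡ p) (mk≡ q) =
    mod-by (ℤ.∣m∣n⇒∣m+n p q) (eq a b c)
    where
    eq : ∀ a b c → (a ℤ.- b) ℤ.+ (b ℤ.- c) ≡ a ℤ.- c
    eq = solve-∀

  mod-+ : ∀ {a b c d} → a ≡ b [mod m ] → c ≡ d [mod m ] →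
          a ℤ.+ c ≡ b ℤ.+ d [mod m ]
  mod-+ {a} {b} {c} {d} (mk≡ p) (mk≡ q) =
    mod-by (ℤ.∣m∣n⇒∣m+n p q) (eq a b c d)
    where
    eq : ∀ a b c d →
         (a ℤ.- b) ℤ.+ (c ℤ.- d) ≡ (a ℤ.+ c) ℤ.- (b ℤ.+ d)
    eq = solve-∀

  mod-neg : ∀ {a b} → a ≡ b [mod m ] → ℤ.- a ≡ ℤ.- b [mod m ]
  mod-neg {a} {b} (mk≡ p) = mod-by (ℤ.∣m⇒∣-m p) (eq a b)
    where
    eq : ∀ a b → ℤ.- (a ℤ.- b) ≡ (ℤ.- a) ℤ.- (ℤ.- b)
    eq = solve-∀

  mod-* : ∀ {a b c d} → a ≡ b [mod m ] → c ≡ d [mod m ] →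
          a ℤ.* c ≡ b ℤ.* d [mod m ]
  mod-* {a} {b} {c} {d} (mk≡ p) (mk≡ q) =
    mod-by (ℤ.∣m∣n⇒∣m+n (ℤ.∣m⇒∣m*n c p) (ℤ.∣n⇒∣m*n b q)) (eq a b c d)
    where
    eq : ∀ a b c d →
         (a ℤ.- b) ℤ.* c ℤ.+ b ℤ.* (c ℤ.- d) ≡ a ℤ.* c ℤ.- b ℤ.* d
    eq = solve-∀

  mod-0 : ∀ {a} → a ≡ + 0 [mod m ] → m ∣ a
  mod-0 {a} (mk≡ p) = subst (m ∣_) (ℤ.+-identityʳ a) p

  0-mod : ∀ {a} → m ∣ a → a ≡ + 0 [mod m ]
  0-mod {a} d = mod-by d (sym (ℤ.+-identityʳ a))

mod-1 : ∀ {a b} → a ≡ b [mod + 1 ]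
mod-1 {a} {b} = mk≡ (divides (a ℤ.- b) (sym (ℤ.*-identityʳ (a ℤ.- b))))

mod-weaken : ∀ {k m a b} → k ∣ m → a ≡ b [mod m ] → a ≡ b [mod k ]
mod-weaken d (mk≡ p) = mk≡ (ℤ.∣-trans d p)

3^∣3^suc : ∀ n → 3^ n ∣ 3^ (suc n)
3^∣3^suc n = divides (+ 3) (ℤ.pos-* 3 (3 ℕ.^ n))

-- The 3-adic integers, as the inverse limit of the rings ℤ/3ⁿ.
record ℤ₃ : Set where
  constructor mkℤ₃
  field
    residue  : ℕ → ℤ   -- only its class modulo 3ⁿ at index n matters
    coherent : ∀ n → residue (suc n) ≡ residue n [mod 3^ n ]

open ℤ₃ public

infix 4 _≈_ _≉_

record _≈_ (x y : ℤ₃) : Set where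
  constructor mk≈
  field
    at : ∀ n → residue x n ≡ residue y n [mod 3^ n ]

open _≈_ public

_≉_ : ℤ₃ → ℤ₃ → Set
x ≉ y = ¬ (x ≈ y)

fromℤ : ℤ → ℤ₃
fromℤ a = mkℤ₃ (λ _ → a) (λ _ → ≡⇒≡mod refl)

fromℕ : ℕ → ℤ₃
fromℕ n = fromℤ (+ n)

infixl 7 _*_
infixl 6 _+_
infix  8 -_

_+_ : ℤ₃ → ℤ₃ → ℤ₃
x + y = mkℤ₃ (λ n → residue x n ℤ.+ residue y n)
             (λ n → mod-+ (coherent x n) (coherent y n))

_*_ : ℤ₃ → ℤ₃ → ℤ₃
x * y = mkℤ₃ (λ n → residue x n ℤ.* residue y n)
             (λ n → mod-* (coherent x n) (coherent y n))

-_ : ℤ₃ → ℤ₃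
- x = mkℤ₃ (λ n → ℤ.- residue x n) (λ n → mod-neg (coherent x n))

pointwise : ∀ {x y} → (∀ n → residue x n ≡ residue y n) → x ≈ y
pointwise eq = mk≈ (λ n → ≡⇒≡mod (eq n))

≈-refl : ∀ {x} → x ≈ x
≈-refl = pointwise (λ _ → refl)

≈-sym : ∀ {x y} → x ≈ y → y ≈ x
≈-sym (mk≈ p) = mk≈ (λ n → mod-sym (p n))

≈-trans : ∀ {x y z} → x ≈ y → y ≈ z → x ≈ z
≈-trans (mk≈ p) (mk≈ q) = mk≈ (λ n → mod-trans (p n) (q n))

ℤ₃-isCommutativeRing :
  IsCommutativeRing _≈_ _+_ _*_ -_ (fromℕ 0) (fromℕ 1)
ℤ₃-isCommutativeRing = record
  { isRing = record
    { +-isAbelianGroup = record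
      { isGroup = record
        { isMonoid = record
          { isSemigroup = record
            { isMagma = record
              { isEquivalence = record
                { refl = ≈-refl ; sym = ≈-sym ; trans = ≈-trans }
              ; ∙-cong = λ (mk≈ p) (mk≈ q) → mk≈ (λ n → mod-+ (p n) (q n))
              }
            ; assoc = λ x y z → pointwise (λ n →
                ℤ.+-assoc (residue x n) (residue y n) (residue z n))
            }
          ; identity = (λ x → pointwise (λ n → ℤ.+-identityˡ (residue x n)))
                     , (λ x → pointwise (λ n → ℤ.+-identityʳ (residue x n)))
          }
        ; inverse = (λ x → pointwise (λ n → ℤ.+-inverseˡ (residue x n)))
                  , (λ x → pointwise (λ n → ℤ.+-inverseʳ (residue x n)))
        ; ⁻¹-cong = λ (mk≈ p) → mk≈ (λ n → mod-neg (p n))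
        }
      ; comm = λ x y → pointwise (λ n → ℤ.+-comm (residue x n) (residue y n))
      }
    ; *-cong = λ (mk≈ p) (mk≈ q) → mk≈ (λ n → mod-* (p n) (q n))
    ; *-assoc = λ x y z → pointwise (λ n →
        ℤ.*-assoc (residue x n) (residue y n) (residue z n))
    ; *-identity = (λ x → pointwise (λ n → ℤ.*-identityˡ (residue x n)))
                 , (λ x → pointwise (λ n → ℤ.*-identityʳ (residue x n)))
    ; distrib = (λ x y z → pointwise (λ n →
          ℤ.*-distribˡ-+ (residue x n) (residue y n) (residue z n)))
              , (λ x y z → pointwise (λ n →
          ℤ.*-distribʳ-+ (residue x n) (residue y n) (residue z n)))
    }
  ; *-comm = λ x y → pointwise (λ n → ℤ.*-comm (residue x n) (residue y n))
  }

ℤ₃-commutativeRing : CommutativeRing 0ℓ 0ℓ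
ℤ₃-commutativeRing = record { isCommutativeRing = ℤ₃-isCommutativeRing }

open CommutativeRing ℤ₃-commutativeRing public
  using (0#; 1#; semiring) renaming (setoid to ℤ₃-setoid)
open Exp semiring public using (_^_)

infix 6 _+3^_ℤ₃

_+3^_ℤ₃ : ℤ₃ → ℕ → Pred ℤ₃ 0ℓ
(a +3^ m ℤ₃) z = ∃[ y ] z ≈ a + fromℤ (3^ m) * y

U⁽_⁾ : ℕ → Pred ℤ₃ 0ℓ
U⁽ m ⁾ = 1# +3^ m ℤ₃

subspace : Pred ℤ₃ 0ℓ → Setoid 0ℓ 0ℓ
subspace P = On.setoid {B = ∃ P} ℤ₃-setoid proj₁

-- The cosets z + 3ᵐℤ₃ are a basis of neighbourhoods of z.  A map into a
-- subspace of ℤ₃ is continuous iff it is so as a map into ℤ₃.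
ContinuousOn : (P : Pred ℤ₃ 0ℓ) → (∃ P → ℤ₃) → Set
ContinuousOn P f = ∀ z n → ∃[ m ] ∀ w →
  proj₁ w ∈ proj₁ z +3^ m ℤ₃ → f w ∈ f z +3^ n ℤ₃

record Homeomorphism (P Q : Pred ℤ₃ 0ℓ) : Set where
  field
    inverse         : Inverse (subspace P) (subspace Q)
  open Inverse inverse public
  field
    to-continuous   : ContinuousOn P (proj₁ ∘ to)
    from-continuous : ContinuousOn Q (proj₁ ∘ from)

geometricSum : ℤ₃ → ℕ → ℤ₃
geometricSum q zero    = 0#
geometricSum q (suc n) = geometricSum q n + q ^ n

record IsIota (q : ℤ₃) (f : ℤ₃ → ℤ₃) : Set where
  field
    continuous   : ContinuousOn U (f ∘ proj₁)
    interpolates : ∀ n → f (fromℕ n) ≈ geometricSum q n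

geo : ℤ → ℕ → ℤ
geo c zero    = + 0
geo c (suc n) = geo c n ℤ.+ c ℤ.^ n

residue-^ : ∀ q k n → residue (q ^ k) n ≡ residue q n ℤ.^ k
residue-^ q zero    n = refl
residue-^ q (suc k) n = cong (residue q n ℤ.*_) (residue-^ q k n)

residue-geo : ∀ q k n → residue (geometricSum q k) n ≡ geo (residue q n) k
residue-geo q zero    n = refl
residue-geo q (suc k) n = cong₂ ℤ._+_ (residue-geo q k n) (residue-^ q k n)

geo-+ : ∀ c m n → geo c (m ℕ.+ n) ≡ geo c m ℤ.+ c ℤ.^ m ℤ.* geo c n
geo-+ c m zero rewrite ℕ.+-identityʳ m = eq (geo c m) (c ℤ.^ m)
  where
  eq : ∀ g p → g ≡ g ℤ.+ p ℤ.* + 0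
  eq = solve-∀
geo-+ c m (suc n)
  rewrite ℕ.+-suc m n | geo-+ c m n | ℤ.^-distribˡ-+-* c m n
  = eq (geo c m) (c ℤ.^ m) (geo c n) (c ℤ.^ n)
  where
  eq : ∀ a p b r →
       (a ℤ.+ p ℤ.* b) ℤ.+ p ℤ.* r ≡ a ℤ.+ p ℤ.* (b ℤ.+ r)
  eq = solve-∀

^≡1 : ∀ {m c} → c ≡ + 1 [mod m ] → ∀ k → c ℤ.^ k ≡ + 1 [mod m ]
^≡1         p zero    = mod-refl
^≡1 {c = c} p (suc k) =
  mod-* {a = c} {b = + 1} {c = c ℤ.^ k} {d = + 1} p (^≡1 p k)

1+x+x² : ∀ {x} → x ≡ + 1 [mod + 3 ] → + 3 ∣ + 1 ℤ.+ (x ℤ.+ x ℤ.* x)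
1+x+x² p = mod-0 (mod-trans
  (mod-+ (mod-refl {a = + 1}) (mod-+ p (mod-* p p))) (mk≡ (divides (+ 1) refl)))

geo-3^ : ∀ {c} → c ≡ + 1 [mod + 3 ] → ∀ n → 3^ n ∣ geo c (3 ℕ.^ n)
geo-3^ {c} p zero    = divides (geo c 1) (sym (ℤ.*-identityʳ _))
geo-3^ {c} p (suc n) with geo-3^ p n | 1+x+x² (^≡1 p (3 ℕ.^ n))
... | divides s e | divides t f = divides (s ℤ.* t) (begin
  geo c (N ℕ.+ (N ℕ.+ (N ℕ.+ 0)))
    ≡⟨ geo-+ c N _ ⟩
  g ℤ.+ x ℤ.* geo c (N ℕ.+ (N ℕ.+ 0))
    ≡⟨ cong (λ h → g ℤ.+ x ℤ.* h) (geo-+ c N _) ⟩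
  g ℤ.+ x ℤ.* (g ℤ.+ x ℤ.* geo c (N ℕ.+ 0))
    ≡⟨ cong (λ k → g ℤ.+ x ℤ.* (g ℤ.+ x ℤ.* geo c k)) (ℕ.+-identityʳ N) ⟩
  g ℤ.+ x ℤ.* (g ℤ.+ x ℤ.* g)
    ≡⟨ eq₁ g x ⟩
  g ℤ.* (+ 1 ℤ.+ (x ℤ.+ x ℤ.* x))
    ≡⟨ cong₂ ℤ._*_ e f ⟩
  s ℤ.* 3^ n ℤ.* (t ℤ.* + 3)
    ≡⟨ eq₂ s (3^ n) t ⟩
  s ℤ.* t ℤ.* (+ 3 ℤ.* 3^ n)
    ≡⟨ cong (s ℤ.* t ℤ.*_) (ℤ.pos-* 3 N) ⟨
  s ℤ.* t ℤ.* 3^ (suc n) ∎)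
  where
  open ≡-Reasoning
  N : ℕ
  N = 3 ℕ.^ n
  g x : ℤ
  g = geo c N
  x = c ℤ.^ N
  eq₁ : ∀ g x → g ℤ.+ x ℤ.* (g ℤ.+ x ℤ.* g)
              ≡ g ℤ.* (+ 1 ℤ.+ (x ℤ.+ x ℤ.* x))
  eq₁ = solve-∀
  eq₂ : ∀ s k t → s ℤ.* k ℤ.* (t ℤ.* + 3) ≡ s ℤ.* t ℤ.* (+ 3 ℤ.* k)
  eq₂ = solve-∀

[c-1]*geo : ∀ c n → (c ℤ.- + 1) ℤ.* geo c n ≡ c ℤ.^ n ℤ.- + 1
[c-1]*geo c zero    = ℤ.*-zeroʳ (c ℤ.- + 1)
[c-1]*geo c (suc n) = begin
  (c ℤ.- + 1) ℤ.* (geo c n ℤ.+ x)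
    ≡⟨ ℤ.*-distribˡ-+ (c ℤ.- + 1) (geo c n) x ⟩
  (c ℤ.- + 1) ℤ.* geo c n ℤ.+ (c ℤ.- + 1) ℤ.* x
    ≡⟨ cong (ℤ._+ (c ℤ.- + 1) ℤ.* x) ([c-1]*geo c n) ⟩
  x ℤ.- + 1 ℤ.+ (c ℤ.- + 1) ℤ.* x
    ≡⟨ eq c x ⟩
  c ℤ.* x ℤ.- + 1 ∎
  where
  open ≡-Reasoning
  x : ℤ
  x = c ℤ.^ n
  eq : ∀ c x → x ℤ.- + 1 ℤ.+ (c ℤ.- + 1) ℤ.* x ≡ c ℤ.* x ℤ.- + 1
  eq = solve-∀

geo-shift : ∀ {m c N} → m ∣ geo c N → ∀ a k →
            geo c (k ℕ.* N ℕ.+ a) ≡ geo c a [mod m ]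
geo-shift             d a zero    = mod-refl
geo-shift {m} {c} {N} d a (suc k) = mod-trans (≡⇒≡mod split)
  (mod-trans (mod-+ (0-mod d) (mod-* c^N≡1 (geo-shift {m} {c} {N} d a k)))
             (≡⇒≡mod (eq (geo c a))))
  where
  split : geo c (N ℕ.+ k ℕ.* N ℕ.+ a)
        ≡ geo c N ℤ.+ c ℤ.^ N ℤ.* geo c (k ℕ.* N ℕ.+ a)
  split = trans (cong (geo c) (ℕ.+-assoc N (k ℕ.* N) a)) (geo-+ c N _)
  c^N≡1 : c ℤ.^ N ≡ + 1 [mod m ]
  c^N≡1 = mod-by (ℤ.∣n⇒∣m*n (c ℤ.- + 1) d) ([c-1]*geo c N)
  eq : ∀ g → + 0 ℤ.+ + 1 ℤ.* g ≡ g
  eq = solve-∀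

geo-cong : ∀ {m c N} → m ∣ geo c N → ∀ {a b} →
           + a ≡ + b [mod + N ] → geo c a ≡ geo c b [mod m ]
geo-cong {m} {c} {N} d {a} {b} (mk≡ (divides (+ k) e)) =
  subst (λ i → geo c i ≡ geo c b [mod m ]) (sym a≡) (geo-shift {m} {c} {N} d b k)
  where
  eq : ∀ x y → x ≡ x ℤ.- y ℤ.+ y
  eq = solve-∀
  a≡ : a ≡ k ℕ.* N ℕ.+ b
  a≡ = ℤ.+-injective (trans (eq (+ a) (+ b))
         (cong (ℤ._+ + b) (trans e (sym (ℤ.pos-* k N)))))
geo-cong {m} {c} {N} d {a} {b} (mk≡ (divides -[1+ k ] e)) =
  subst (λ i → geo c a ≡ geo c i [mod m ]) (sym b≡)
    (mod-sym (geo-shift {m} {c} {N} d a (suc k)))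
  where
  eq : ∀ x y → y ≡ ℤ.- (x ℤ.- y) ℤ.+ x
  eq = solve-∀
  b≡ : b ≡ suc k ℕ.* N ℕ.+ a
  b≡ = ℤ.+-injective (trans (eq (+ a) (+ b)) (cong (ℤ._+ + a)
         (trans (cong ℤ.-_ e)
           (trans (ℤ.neg-distribˡ-* -[1+ k ] (+ N))
             (sym (ℤ.pos-* (suc k) N))))))

representative : ℤ₃ → ℕ → ℕ
representative z n = residue z n ℤ.%ℕ (3 ℕ.^ n)
  where instance _ = ℕ.m^n≢0 3 n

representative-≡ : ∀ z n → + representative z n ≡ residue z n [mod 3^ n ]
representative-≡ z n = mod-sym (mk≡ (divides (residue z n ℤ./ℕ (3 ℕ.^ n)) (begin
  residue z n ℤ.- + r
    ≡⟨ cong (ℤ._- + r) (ℤ.a≡a%ℕn+[a/ℕn]*n (residue z n) (3 ℕ.^ n)) ⟩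
  (+ r ℤ.+ t) ℤ.- + r
    ≡⟨ eq (+ r) t ⟩
  t ∎)))
  where
  instance _ = ℕ.m^n≢0 3 n
  open ≡-Reasoning
  r = representative z n
  t = (residue z n ℤ./ℕ (3 ℕ.^ n)) ℤ.* 3^ n
  eq : ∀ r t → r ℤ.+ t ℤ.- r ≡ t
  eq = solve-∀

U⁽¹⁾-residue : ∀ {q} → q ∈ U⁽ 1 ⁾ → ∀ n →
               residue q (suc n) ≡ + 1 [mod + 3 ]
U⁽¹⁾-residue {q} (y , e) zero =
  mod-trans (at e 1) (mk≡ (divides (residue y 1) (eq (residue y 1))))
  where
  eq : ∀ y → + 1 ℤ.+ + 3 ℤ.* y ℤ.- + 1 ≡ y ℤ.* + 3
  eq = solve-∀
U⁽¹⁾-residue {q} q∈ (suc n) = mod-trans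
  (mod-weaken (divides (3^ n) (trans (ℤ.pos-* 3 (3 ℕ.^ n)) (ℤ.*-comm (+ 3) (3^ n))))
    (coherent q (suc n)))
  (U⁽¹⁾-residue q∈ n)

sum-cong : ∀ {q} → q ∈ U⁽ 1 ⁾ → ∀ n {a b} → + a ≡ + b [mod 3^ n ] →
           residue (geometricSum q a) n ≡ residue (geometricSum q b) n [mod 3^ n ]
sum-cong _ zero _ = mod-1
sum-cong {q} q∈ n@(suc k) {a} {b} p = mod-trans (≡⇒≡mod (residue-geo q a n))
  (mod-trans (geo-cong {3^ n} {residue q n} {3 ℕ.^ n}
               (geo-3^ (U⁽¹⁾-residue {q} q∈ k) n) p)
             (≡⇒≡mod (sym (residue-geo q b n))))

-- Modulo 3ⁿ, ι_q(z) is the geometric sum of length the natural number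
-- representing z modulo 3ⁿ.  By ι-isIota and ι-unique below, this is the
-- unique continuous function interpolating the geometric sums.
ι : ∃ U⁽ 1 ⁾ → ℤ₃ → ℤ₃
ι (q , q∈) z = mkℤ₃ (λ n → residue (geometricSum q (representative z n)) n) λ n →
  mod-trans (coherent (geometricSum q (representative z (suc n))) n)
    (sum-cong {q} q∈ n
      (mod-trans (mod-weaken (3^∣3^suc n) (representative-≡ z (suc n)))
        (mod-trans (coherent z n) (mod-sym (representative-≡ z n)))))

coset⇒mod : ∀ a z m → z ∈ a +3^ m ℤ₃ → residue z m ≡ residue a m [mod 3^ m ]
coset⇒mod a z m (y , e) = mod-trans (at e m)
  (mk≡ (divides (residue y m) (eq (residue a m) (3^ m) (residue y m))))
  where
  eq : ∀ a k y → a ℤ.+ k ℤ.* y ℤ.- a ≡ y ℤ.* k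
  eq = solve-∀

3^-+ : ∀ m n → 3^ (m ℕ.+ n) ≡ 3^ m ℤ.* 3^ n
3^-+ m n = trans (cong +_ (ℕ.^-distribˡ-+-* 3 m n)) (ℤ.pos-* (3 ℕ.^ m) (3 ℕ.^ n))

coherent-+ : ∀ x m n → residue x (m ℕ.+ n) ≡ residue x n [mod 3^ n ]
coherent-+ x zero    n = ≡⇒≡mod refl
coherent-+ x (suc m) n = mod-trans
  (mod-weaken (divides (3^ m) (3^-+ m n)) (coherent x (m ℕ.+ n)))
  (coherent-+ x m n)

mod⇒coset : ∀ a z m → residue z m ≡ residue a m [mod 3^ m ] → z ∈ a +3^ m ℤ₃
mod⇒coset a z m p = y , mk≈ λ n → mod-trans
  (mod-sym (coherent-+ z m n))
  (mod-trans (≡⇒≡mod (split n)) (mod-+ (coherent-+ a m n) (≡⇒≡mod refl)))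
  where
  diff : ∀ n → 3^ m ∣ residue z (m ℕ.+ n) ℤ.- residue a (m ℕ.+ n)
  diff n rewrite ℕ.+-comm m n = difference
    (mod-trans (coherent-+ z n m) (mod-trans p (mod-sym (coherent-+ a n m))))
  quot : ℕ → ℤ
  quot n = _∣_.quotient (diff n)
  quot-eq : ∀ n → residue z (m ℕ.+ n) ℤ.- residue a (m ℕ.+ n) ≡ 3^ m ℤ.* quot n
  quot-eq n = trans (_∣_.equality (diff n)) (ℤ.*-comm (quot n) (3^ m))
  split : ∀ n → residue z (m ℕ.+ n) ≡ residue a (m ℕ.+ n) ℤ.+ 3^ m ℤ.* quot n
  split n = trans (eq (residue z (m ℕ.+ n)) (residue a (m ℕ.+ n)))
                  (cong (λ d → residue a (m ℕ.+ n) ℤ.+ d) (quot-eq n))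
    where
    eq : ∀ z a → z ≡ a ℤ.+ (z ℤ.- a)
    eq = solve-∀
  y-coherent : ∀ n → quot (suc n) ≡ quot n [mod 3^ n ]
  y-coherent n = mk≡ (ℤ.*-cancelˡ-∣ (3^ m) {{ℕ.m^n≢0 3 m}}
    (subst (_∣ 3^ m ℤ.* (quot (suc n) ℤ.- quot n)) (3^-+ m n)
      (subst (3^ (m ℕ.+ n) ∣_) rearrange
        (difference (mod-+ (step z) (mod-neg (step a)))))))
    where
    step : ∀ x → residue x (m ℕ.+ suc n) ≡ residue x (m ℕ.+ n) [mod 3^ (m ℕ.+ n) ]
    step x rewrite ℕ.+-suc m n = coherent x (m ℕ.+ n)
    eq : ∀ k s t → k ℤ.* s ℤ.- k ℤ.* t ≡ k ℤ.* (s ℤ.- t)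
    eq = solve-∀
    rearrange : (residue z (m ℕ.+ suc n) ℤ.- residue a (m ℕ.+ suc n))
                ℤ.- (residue z (m ℕ.+ n) ℤ.- residue a (m ℕ.+ n))
                ≡ 3^ m ℤ.* (quot (suc n) ℤ.- quot n)
    rearrange = trans (cong₂ ℤ._-_ (quot-eq (suc n)) (quot-eq n))
                      (eq (3^ m) (quot (suc n)) (quot n))
  y : ℤ₃
  y = mkℤ₃ quot y-coherent

ι-isIota : ∀ q → IsIota (proj₁ q) (ι q)
ι-isIota q = record
  { continuous   = λ z n → n , λ w w∈ → mod⇒coset (ι q (proj₁ z)) (ι q (proj₁ w)) n
      (sum-cong {proj₁ q} (proj₂ q) n
        (mod-trans (representative-≡ (proj₁ w) n)
          (mod-trans (coset⇒mod (proj₁ z) (proj₁ w) n w∈)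
            (mod-sym (representative-≡ (proj₁ z) n)))))
  ; interpolates = λ k → mk≈ λ n →
      sum-cong {proj₁ q} (proj₂ q) n (representative-≡ (fromℕ k) n)
  }

ι-unique : ∀ q {f} → IsIota (proj₁ q) f → ∀ z → f z ≈ ι q z
ι-unique q {f} f-isIota z = mk≈ at-level
  where
  open IsIota
  at-level : ∀ n → residue (f z) n ≡ residue (ι q z) n [mod 3^ n ]
  at-level n = mod-trans (mod-sym f-near)
    (mod-trans (at (interpolates f-isIota k) n)
      (mod-trans (mod-sym (at (interpolates (ι-isIota q) k) n)) ι-near))
    where
    f-cont : ∃[ m ] ∀ w → proj₁ w ∈ z +3^ m ℤ₃ → f (proj₁ w) ∈ f z +3^ n ℤ₃
    f-cont = continuous f-isIota (z , _) n
    m l k : ℕ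
    m = proj₁ f-cont
    l = n ℕ.+ m
    k = representative z l
    near : ∀ i j → j ℕ.+ i ≡ l → fromℕ k ∈ z +3^ i ℤ₃
    near i j j+i≡l = mod⇒coset z (fromℕ k) i (mod-trans
      (mod-weaken (subst (λ h → 3^ i ∣ 3^ h) j+i≡l (divides (3^ j) (3^-+ j i)))
        (representative-≡ z l))
      (subst (λ h → residue z h ≡ residue z i [mod 3^ i ]) j+i≡l
        (coherent-+ z j i)))
    f-near : residue (f (fromℕ k)) n ≡ residue (f z) n [mod 3^ n ]
    f-near = coset⇒mod (f z) (f (fromℕ k)) n
      (proj₂ f-cont (fromℕ k , _) (near m n refl))
    ι-near : residue (ι q (fromℕ k)) n ≡ residue (ι q z) n [mod 3^ n ]
    ι-near = coset⇒mod (ι q z) (ι q (fromℕ k)) n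
      (proj₂ (continuous (ι-isIota q) (z , _) n) (fromℕ k , _)
        (near n m (ℕ.+-comm m n)))

3ℤ₃∪1+3ℤ₃ : Pred ℤ₃ 0ℓ
3ℤ₃∪1+3ℤ₃ = (0# +3^ 1 ℤ₃) ∪ (1# +3^ 1 ℤ₃)

zero∈ one∈ : ∃ 3ℤ₃∪1+3ℤ₃
zero∈ = 0# , inj₁ (mod⇒coset 0# 0# 1 mod-refl)
one∈  = 1# , inj₂ (mod⇒coset 1# 1# 1 mod-refl)

U⁽¹⁾∖U⁽²⁾ : Pred ℤ₃ 0ℓ
U⁽¹⁾∖U⁽²⁾ = U⁽ 1 ⁾ ∖ U⁽ 2 ⁾

IsFixedPoint : ∃ U⁽¹⁾∖U⁽²⁾ → ℤ₃ → Set
IsFixedPoint (q , q∈U⁽¹⁾ , _) z = ι (q , q∈U⁽¹⁾) z ≈ z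

NoNontrivialFixedPoint : ∃ U⁽¹⁾∖U⁽²⁾ → Set
NoNontrivialFixedPoint q = ¬ (∃[ z ] IsFixedPoint q z × z ≉ 0# × z ≉ 1#)

ExceptionalMod9 : ℕ → ∃ U⁽¹⁾∖U⁽²⁾ → Set
ExceptionalMod9 a q = proj₁ q ∈ fromℕ a +3^ 2 ℤ₃ × NoNontrivialFixedPoint q

infix 4 _≈′_

_≈′_ : ∃ U⁽¹⁾∖U⁽²⁾ → ∃ U⁽¹⁾∖U⁽²⁾ → Set
_≈′_ = Setoid._≈_ (subspace U⁽¹⁾∖U⁽²⁾)

-- ∃ (IsTheUnique P) unfolds to ∃! _≈′_ P.
IsTheUnique : (∃ U⁽¹⁾∖U⁽²⁾ → Set) → ∃ U⁽¹⁾∖U⁽²⁾ → Set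
IsTheUnique P q = P q × (∀ {q′} → P q′ → q ≈′ q′)

{-# OPTIONS --safe #-}
module Submission where

-- Put q = 1 + 3a and t = z - 2.  The binomial series gives
--   2(ι_q(z) - z) = 3a · z(z-1) · E(t, a),
--   E(t, a) = Σ_j 2·3ʲ/(j+2)! · aʲ · t(t-1)⋯(t-j+1) = 1 + ta + 3G(t, a),
-- where G is a 3-adic limit of polynomials and hence 1-Lipschitz.  So the
-- nontrivial fixed points of ι_q are given by E(t, a) = 0, and modulo 3 this
-- equation reads ta = -1.  By Newton iteration every unit t determines a unique
-- unit a and conversely, and both maps are 1-Lipschitz.  The exceptional
-- q₀ and q₁ are those for which the root z of E is the trivial point 0 or 1.

open import Defs
open import Data.Empty using (⊥-elim)
open import Data.Fin.Base using (zero; suc)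
open import Data.Integer.Base as ℤ using (ℤ; +_)
import Data.Integer.DivMod as ℤ
open import Data.Integer.Divisibility.Signed as ℤ using (_∣_; _∣?_; divides)
import Data.Integer.Properties as ℤ
open import Data.Integer.Tactic.RingSolver using (solve-∀)
open import Data.Nat.Base as ℕ using (ℕ; zero; suc; ⌊_/2⌋; ⌈_/2⌉; _!)
open import Data.Nat.DivMod using (_divMod_; result)
open import Data.Nat.Induction using (<-rec)
import Data.Nat.Properties as ℕ
import Data.Nat.Tactic.RingSolver as ℕ-solver
open import Data.Product using (∃; ∃-syntax; _×_; _,_; proj₁; proj₂)
open import Data.Sum.Base using (inj₁; inj₂)
open import Function.Base using (flip)
open import Relation.Binary.PropositionalEquality
  using (_≡_; refl; sym; trans; cong; subst)
open import Relation.Nullary using (¬_; Dec; yes; no; contradiction)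
open import Relation.Nullary.Decidable
  using (map′; from-yes; from-no; decidable-stable)
open import Relation.Unary using (_∈_)

-- Congruence modulo 3ⁿ

-- For q = 1 + 3a, `ι_q(z)` is the sum over k ≥ 1 of `(3a)^(k-1) binom(z, k)`. The term k = 1 is z,
-- and every later term contains `3a z(z-1)`, also when a = 0. Doubling makes the first two
-- quotients 2/2! and 2·3/3! equal to 1, which is why E begins with exactly `1 + ta`. In the
-- coefficient of index j, the bound v₃((j+2)!) ≤ ⌈j/2⌉ leaves a factor 3^⌊j/2⌋: it supplies the 3
-- in front of G and the convergence of the series.
--
-- The leading part `1 + xy` is symmetric, so one solver serves both variables. Its uniqueness
-- statement concerns approximate roots modulo 3ⁿ; that Ψ and its inverse undo each other, that they
-- are continuous, and the classes of q₀ and q₁ modulo 9 are all instances of it.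
--
-- Only congruence modulo a fixed 3ⁿ is decidable here, and z ≉ 0 yields no level at which z is
-- nonzero. Cancellation and the removal of double negations therefore take place one level at a
-- time.

infixl 7 _⊗_
infixl 6 _⊕_ _⊖_

-- Opaque copies of the ring operations, so that unification does not unfold
-- the coherence proofs inside elements of ℤ₃.
opaque
  _⊕_ _⊗_ _⊖_ : ℤ₃ → ℤ₃ → ℤ₃
  x ⊕ y = x + y
  x ⊗ y = x * y
  x ⊖ y = x + - y

infix 4 _≈[_]_

-- By coherence, the comparison at index n alone settles all lower indices. The record keeps x and y
-- inferable from the type.
record _≈[_]_ (x : ℤ₃) (n : ℕ) (y : ℤ₃) : Set where
  constructor mk≈[]
  field
    level : residue x n ≡ residue y n [mod 3^ n ]

open _≈[_]_

≈⇒≈[] : ∀ {x y n} → x ≈ y → x ≈[ n ] y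
≈⇒≈[] {n = n} p = mk≈[] (at p n)

≈[]⇒≈ : ∀ {x y} → (∀ n → x ≈[ n ] y) → x ≈ y
≈[]⇒≈ p = mk≈ λ n → level (p n)

≈[]-refl : ∀ {x n} → x ≈[ n ] x
≈[]-refl = mk≈[] mod-refl

≈[]-sym : ∀ {x y n} → x ≈[ n ] y → y ≈[ n ] x
≈[]-sym (mk≈[] p) = mk≈[] (mod-sym p)

≈[]-trans : ∀ {x y z n} → x ≈[ n ] y → y ≈[ n ] z → x ≈[ n ] z
≈[]-trans (mk≈[] p) (mk≈[] q) = mk≈[] (mod-trans p q)

≈[0] : ∀ {x y} → x ≈[ 0 ] y
≈[0] = mk≈[] mod-1

lower : ∀ {x y} n → x ≈[ suc n ] y → x ≈[ n ] y
lower {x} {y} n (mk≈[] p) = mk≈[] (mod-trans (mod-sym (coherent x n))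
  (mod-trans (mod-weaken (3^∣3^suc n) p) (coherent y n)))

opaque
  unfolding _⊕_

  ⊕-cong : ∀ {n x x′ y y′} → x ≈[ n ] x′ → y ≈[ n ] y′ → x ⊕ y ≈[ n ] x′ ⊕ y′
  ⊕-cong (mk≈[] p) (mk≈[] q) = mk≈[] (mod-+ p q)

  ⊗-cong : ∀ {n x x′ y y′} → x ≈[ n ] x′ → y ≈[ n ] y′ → x ⊗ y ≈[ n ] x′ ⊗ y′
  ⊗-cong {n} {x} {x′} {y} {y′} (mk≈[] p) (mk≈[] q) =
    mk≈[] (mod-* {3^ n} {residue x n} {residue x′ n} {residue y n} p q)

  ⊖-cong : ∀ {n x x′ y y′} → x ≈[ n ] x′ → y ≈[ n ] y′ → x ⊖ y ≈[ n ] x′ ⊖ y′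
  ⊖-cong (mk≈[] p) (mk≈[] q) = mk≈[] (mod-+ p (mod-neg q))

  ⊖⇒≈[] : ∀ {n x y} → x ⊖ y ≈[ n ] 0# → x ≈[ n ] y
  ⊖⇒≈[] (mk≈[] p) = mk≈[] (mk≡ (mod-0 p))

  ≈[]⇒⊖ : ∀ {n x y} → x ≈[ n ] y → x ⊖ y ≈[ n ] 0#
  ≈[]⇒⊖ (mk≈[] (mk≡ p)) = mk≈[] (0-mod p)

  ⊕-0 : ∀ {n x y} → x ≈[ n ] 0# → y ≈[ n ] 0# → x ⊕ y ≈[ n ] 0#
  ⊕-0 (mk≈[] p) (mk≈[] q) = mk≈[] (mod-+ p q)

  ⊖-0 : ∀ {n x y} → x ≈[ n ] 0# → y ≈[ n ] 0# → x ⊖ y ≈[ n ] 0#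
  ⊖-0 (mk≈[] p) (mk≈[] q) = mk≈[] (mod-+ p (mod-neg q))

  ⊗-zeroʳ : ∀ x {n y} → y ≈[ n ] 0# → x ⊗ y ≈[ n ] 0#
  ⊗-zeroʳ x {n} {y} (mk≈[] p) = mk≈[] (0-mod (ℤ.∣n⇒∣m*n (residue x n) (mod-0 p)))

  -- Valuations add. With `three` as one factor, this is the gain of one level on which the
  -- inductions below rest.
  ⊗-0-+ : ∀ {m n x y} → x ≈[ m ] 0# → y ≈[ n ] 0# → x ⊗ y ≈[ m ℕ.+ n ] 0#
  ⊗-0-+ {m} {n} {x} {y} (mk≈[] p) (mk≈[] q) = mk≈[] (0-mod
    (subst (_∣ X ℤ.* Y) (sym (3^-+ m n)) (ℤ.∣-trans
      (ℤ.*-monoˡ-∣ (3^ n) (mod-0 p′)) (ℤ.*-monoʳ-∣ X (mod-0 q′)))))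
    where
    X Y : ℤ
    X = residue x (m ℕ.+ n)
    Y = residue y (m ℕ.+ n)
    p′ : X ≡ + 0 [mod 3^ m ]
    p′ = mod-trans (subst (λ k → residue x k ≡ residue x m [mod 3^ m ])
           (ℕ.+-comm n m) (coherent-+ x n m)) p
    q′ : Y ≡ + 0 [mod 3^ n ]
    q′ = mod-trans (coherent-+ y m n) q

three : ℤ₃
three = fromℕ 3

three≈0 : three ≈[ 1 ] 0#
three≈0 = mk≈[] (mk≡ (divides (+ 1) refl))

-- Being prime to 3, phrased so that x is its own inverse modulo 3 and no inverse has to be carried
-- along.
Unit : ℤ₃ → Set
Unit x = x ⊗ x ≈[ 1 ] fromℕ 1

≈-≈[]-trans : ∀ {n x y z} → x ≈ y → y ≈[ n ] z → x ≈[ n ] z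
≈-≈[]-trans p = ≈[]-trans (≈⇒≈[] p)

-- y = (1 - x²) y + x (x y) with 3 ∣ 1 - x².
unit-cancel : ∀ n {x y} → Unit x → x ⊗ y ≈[ n ] 0# → y ≈[ n ] 0#
unit-cancel zero    u p = ≈[0]
unit-cancel (suc n) {x} {y} u p = ≈-≈[]-trans (split x y)
  (⊕-0 (⊗-0-+ (≈[]⇒⊖ (≈[]-sym u)) (unit-cancel n u (lower n p))) (⊗-zeroʳ x p))
  where
  opaque
    unfolding _⊕_
    split : ∀ x y → y ≈ (fromℕ 1 ⊖ x ⊗ x) ⊗ y ⊕ x ⊗ (x ⊗ y)
    split x y = pointwise λ n → eq (residue x n) (residue y n)
      where
      eq : ∀ x y → y ≡ (+ 1 ℤ.- x ℤ.* x) ℤ.* y ℤ.+ x ℤ.* (x ℤ.* y)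
      eq = solve-∀

-- Implicit functions by Newton iteration

limit : (s : ℕ → ℤ₃) → (∀ n → s (suc n) ≈[ n ] s n) → ℤ₃
limit s p = mkℤ₃ (λ n → residue (s n) n)
  λ n → mod-trans (coherent (s (suc n)) n) (level (p n))

limit-≈[] : ∀ s p n → limit s p ≈[ n ] s n
limit-≈[] s p n = mk≈[] mod-refl

-- The 1-Lipschitz condition, jointly in both variables.
Congruent₂ : (ℤ₃ → ℤ₃ → ℤ₃) → Set
Congruent₂ G = ∀ {n x x′ y y′} → x ≈[ n ] x′ → y ≈[ n ] y′ → G x y ≈[ n ] G x′ y′

module Implicit (G : ℤ₃ → ℤ₃ → ℤ₃) (G-cong : Congruent₂ G) where

  E : ℤ₃ → ℤ₃ → ℤ₃
  E x y = fromℕ 1 ⊕ x ⊗ y ⊕ three ⊗ G x y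

  E-cong : Congruent₂ E
  E-cong p q = ⊕-cong (⊕-cong ≈[]-refl (⊗-cong p q)) (⊗-cong ≈[]-refl (G-cong p q))

  -- Subtracting the two equations expresses `x (y - y′)` through `E - E′`, `x - x′` and
  -- `3 (G - G′)`. Agreement of y and y′ modulo 3ⁿ thus improves to 3ⁿ⁺¹, as the factor 3
  -- compensates for the lost level.
  root-unique : ∀ n {x x′ y y′} → Unit x → x ≈[ n ] x′ →
                E x y ≈[ n ] 0# → E x′ y′ ≈[ n ] 0# → y ≈[ n ] y′
  root-unique zero    u p e e′ = ≈[0]
  root-unique (suc n) {x} {x′} {y} {y′} u p e e′ = ⊖⇒≈[] (unit-cancel (suc n) u
    (≈-≈[]-trans (split x x′ y y′ (G x y) (G x′ y′))
      (⊖-0 (⊖-0 e e′) (⊕-0 (⊗-zeroʳ y′ (≈[]⇒⊖ p))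
        (⊗-0-+ three≈0 (≈[]⇒⊖ (G-cong (lower n p)
          (root-unique n u (lower n p) (lower n e) (lower n e′)))))))))
    where
    opaque
      unfolding _⊕_
      split : ∀ x x′ y y′ g g′ → x ⊗ (y ⊖ y′) ≈
              ((fromℕ 1 ⊕ x ⊗ y ⊕ three ⊗ g) ⊖ (fromℕ 1 ⊕ x′ ⊗ y′ ⊕ three ⊗ g′))
              ⊖ (y′ ⊗ (x ⊖ x′) ⊕ three ⊗ (g ⊖ g′))
      split x x′ y y′ g g′ = pointwise λ n →
        eq (residue x n) (residue x′ n) (residue y n) (residue y′ n) (residue g n) (residue g′ n)
        where
        eq : ∀ x x′ y y′ g g′ → x ℤ.* (y ℤ.- y′) ≡
             ((+ 1 ℤ.+ x ℤ.* y ℤ.+ + 3 ℤ.* g) ℤ.- (+ 1 ℤ.+ x′ ℤ.* y′ ℤ.+ + 3 ℤ.* g′))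
             ℤ.- (y′ ℤ.* (x ℤ.- x′) ℤ.+ + 3 ℤ.* (g ℤ.- g′))
        eq = solve-∀

  -- Modulo 3 the equation reads xy = -1, whence y² = x²y² = 1.
  root-unit : ∀ {x y} → Unit x → E x y ≈[ 1 ] 0# → Unit y
  root-unit {x} {y} u e = ⊖⇒≈[] (≈-≈[]-trans (split x y (G x y))
    (⊕-0 (⊗-zeroʳ _ (≈[]⇒⊖ (≈[]-sym u)))
      -- The level 1 = 1 + 0 comes from `three` alone; nothing is asked of G.
      (⊗-zeroʳ _ (⊖-0 e (⊗-0-+ {n = 0} three≈0 ≈[0])))))
    where
    opaque
      unfolding _⊕_
      split : ∀ x y g → y ⊗ y ⊖ fromℕ 1 ≈
              y ⊗ y ⊗ (fromℕ 1 ⊖ x ⊗ x)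
              ⊕ (x ⊗ y ⊖ fromℕ 1) ⊗ ((fromℕ 1 ⊕ x ⊗ y ⊕ three ⊗ g) ⊖ three ⊗ g)
      split x y g = pointwise λ n → eq (residue x n) (residue y n) (residue g n)
        where
        eq : ∀ x y g → y ℤ.* y ℤ.- + 1 ≡
             y ℤ.* y ℤ.* (+ 1 ℤ.- x ℤ.* x)
             ℤ.+ (x ℤ.* y ℤ.- + 1) ℤ.* ((+ 1 ℤ.+ x ℤ.* y ℤ.+ + 3 ℤ.* g) ℤ.- + 3 ℤ.* g)
        eq = solve-∀

  module _ {x : ℤ₃} (u : Unit x) where

    -- The derivative of E in y is replaced by its leading part x, and 1/x by x, which is right
    -- modulo 3. Each step then gains one digit. Any start would do, since level 0 imposes no
    -- condition.
    newton : ℕ → ℤ₃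
    newton zero    = 0#
    newton (suc n) = newton n ⊖ x ⊗ E x (newton n)

    newton-step : ∀ {n} y → E x y ≈[ n ] 0# → y ⊖ x ⊗ E x y ≈[ n ] y
    newton-step y e = ⊖⇒≈[] (≈-≈[]-trans (split x y (E x y)) (⊗-zeroʳ _ e))
      where
      opaque
        unfolding _⊕_
        split : ∀ x y e → (y ⊖ x ⊗ e) ⊖ y ≈ (0# ⊖ x) ⊗ e
        split x y e = pointwise λ n → eq (residue x n) (residue y n) (residue e n)
          where
          eq : ∀ x y e → (y ℤ.- x ℤ.* e) ℤ.- y ≡ (+ 0 ℤ.- x) ℤ.* e
          eq = solve-∀

    -- With e the old error, the new one is `(1 - x²) e + 3 (G′ - G)`, and both summands have gained
    -- a factor 3.
    newton-root : ∀ n → E x (newton n) ≈[ n ] 0#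
    newton-root zero    = ≈[0]
    newton-root (suc n) = ≈-≈[]-trans (split x y (G x y) (G x (y ⊖ x ⊗ E x y)))
      (⊕-0 (⊗-0-+ (≈[]⇒⊖ (≈[]-sym u)) e)
        (⊗-0-+ three≈0 (≈[]⇒⊖ (G-cong ≈[]-refl (newton-step y e)))))
      where
      y : ℤ₃
      y = newton n
      e : E x y ≈[ n ] 0#
      e = newton-root n
      opaque
        unfolding _⊕_
        split : ∀ x y g g′ → let e = fromℕ 1 ⊕ x ⊗ y ⊕ three ⊗ g in
                fromℕ 1 ⊕ x ⊗ (y ⊖ x ⊗ e) ⊕ three ⊗ g′ ≈
                (fromℕ 1 ⊖ x ⊗ x) ⊗ e ⊕ three ⊗ (g′ ⊖ g)
        split x y g g′ = pointwise λ n →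
          eq (residue x n) (residue y n) (residue g n) (residue g′ n)
          where
          eq : ∀ x y g g′ → + 1 ℤ.+ x ℤ.* (y ℤ.- x ℤ.* (+ 1 ℤ.+ x ℤ.* y ℤ.+ + 3 ℤ.* g)) ℤ.+ + 3 ℤ.* g′ ≡
               (+ 1 ℤ.- x ℤ.* x) ℤ.* (+ 1 ℤ.+ x ℤ.* y ℤ.+ + 3 ℤ.* g) ℤ.+ + 3 ℤ.* (g′ ℤ.- g)
          eq = solve-∀

    newton-cauchy : ∀ n → newton (suc n) ≈[ n ] newton n
    newton-cauchy n = newton-step (newton n) (newton-root n)

    root : ℤ₃
    root = limit newton newton-cauchy

    root-isRoot : E x root ≈ 0#
    root-isRoot = ≈[]⇒≈ λ n →
      ≈[]-trans (E-cong ≈[]-refl (limit-≈[] newton newton-cauchy n)) (newton-root n)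

-- Valuations of factorials

opaque
  unfolding _⊕_

  -- Dividing by 3ᵉ costs e levels, so the hypothesis is read at index e + n.
  3^-cancel : ∀ e {x} → fromℤ (3^ e) ⊗ x ≈ 0# → x ≈ 0#
  3^-cancel e {x} (mk≈ p) = mk≈ λ n → mod-trans (mod-sym (coherent-+ x e n))
    (0-mod (ℤ.*-cancelˡ-∣ (3^ e) {{ℕ.m^n≢0 3 e}}
      (subst (_∣ 3^ e ℤ.* residue x (e ℕ.+ n)) (3^-+ e n) (mod-0 (p (e ℕ.+ n))))))

  3^-⊗ : ∀ e f → fromℤ (3^ e) ⊗ fromℤ (3^ f) ≈ fromℤ (3^ (e ℕ.+ f))
  3^-⊗ e f = pointwise λ n → sym (3^-+ e f)

⊗-cong-≈ : ∀ {x x′ y y′} → x ≈ x′ → y ≈ y′ → x ⊗ y ≈ x′ ⊗ y′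
⊗-cong-≈ p q = ≈[]⇒≈ λ n → ⊗-cong (≈⇒≈[] p) (≈⇒≈[] q)

-- With G = 0 the implicit equation is 1 + xy = 0, whose root is minus the inverse.
inverse : ∀ {x} → Unit x → ∃[ y ] x ⊗ y ≈ fromℕ 1
inverse {x} u = 0# ⊖ root u , ≈[]⇒≈ λ n →
  ⊖⇒≈[] (≈[]-trans (≈⇒≈[] (split x (root u))) (⊖-0 ≈[]-refl (≈⇒≈[] (root-isRoot u))))
  where
  open Implicit (λ _ _ → 0#) (λ _ _ → ≈[]-refl)
  opaque
    unfolding _⊕_
    split : ∀ x y → x ⊗ (0# ⊖ y) ⊖ fromℕ 1 ≈ 0# ⊖ (fromℕ 1 ⊕ x ⊗ y ⊕ three ⊗ 0#)
    split x y = pointwise λ n → eq (residue x n) (residue y n)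
      where
      eq : ∀ x y → x ℤ.* (+ 0 ℤ.- y) ℤ.- + 1 ≡ + 0 ℤ.- (+ 1 ℤ.+ x ℤ.* y ℤ.+ + 3 ℤ.* + 0)
      eq = solve-∀

-- Divisibility of 3ᵉ by k in ℤ₃, that is, v₃(k) ≤ e.
infix 4 _∣3^_

record _∣3^_ (k e : ℕ) : Set where
  constructor mk∣
  field
    cofactor : ℤ₃
    equality : fromℕ k ⊗ cofactor ≈ fromℤ (3^ e)

open _∣3^_

∣3^-* : ∀ {k l e f} → k ∣3^ e → l ∣3^ f → k ℕ.* l ∣3^ e ℕ.+ f
∣3^-* {k} {l} {e} {f} (mk∣ c p) (mk∣ d q) = mk∣ (c ⊗ d)
  (≈-trans (interchange k l c d) (≈-trans (⊗-cong-≈ p q) (3^-⊗ e f)))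
  where
  opaque
    unfolding _⊕_
    interchange : ∀ k l c d → fromℕ (k ℕ.* l) ⊗ (c ⊗ d) ≈ fromℕ k ⊗ c ⊗ (fromℕ l ⊗ d)
    interchange k l c d = pointwise λ n →
      trans (cong (ℤ._* (residue c n ℤ.* residue d n)) (ℤ.pos-* k l))
        (eq (+ k) (+ l) (residue c n) (residue d n))
      where
      eq : ∀ k l c d → k ℤ.* l ℤ.* (c ℤ.* d) ≡ k ℤ.* c ℤ.* (l ℤ.* d)
      eq = solve-∀

∣3^-suc : ∀ {k e} → k ∣3^ e → k ∣3^ suc e
∣3^-suc {k} {e} (mk∣ d p) = mk∣ (three ⊗ d)
  (≈-trans (swap (fromℕ k) d) (≈-trans (⊗-cong-≈ ≈-refl p) (3^-⊗ 1 e)))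
  where
  opaque
    unfolding _⊕_
    swap : ∀ k d → k ⊗ (three ⊗ d) ≈ three ⊗ (k ⊗ d)
    swap k d = pointwise λ n → eq (residue k n) (residue d n)
      where
      eq : ∀ k d → k ℤ.* (+ 3 ℤ.* d) ≡ + 3 ℤ.* (k ℤ.* d)
      eq = solve-∀

opaque
  unfolding _⊕_

  3∣3^ : 3 ∣3^ 1
  3∣3^ = mk∣ (fromℕ 1) (pointwise λ n → refl)

  3n+1-unit : ∀ n → Unit (fromℕ (1 ℕ.+ n ℕ.* 3))
  3n+1-unit n = mk≈[] (mk≡ (divides (+ n ℤ.* (+ 2 ℤ.+ + n ℤ.* + 3))
    (trans (cong (λ x → (+ 1 ℤ.+ x) ℤ.* (+ 1 ℤ.+ x) ℤ.- + 1) (ℤ.pos-* n 3)) (eq (+ n)))))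
    where
    eq : ∀ n → (+ 1 ℤ.+ n ℤ.* + 3) ℤ.* (+ 1 ℤ.+ n ℤ.* + 3) ℤ.- + 1
             ≡ n ℤ.* (+ 2 ℤ.+ n ℤ.* + 3) ℤ.* + 3
    eq = solve-∀

  3n+2-unit : ∀ n → Unit (fromℕ (2 ℕ.+ n ℕ.* 3))
  3n+2-unit n = mk≈[] (mk≡ (divides (+ 1 ℤ.+ + n ℤ.* (+ 4 ℤ.+ + n ℤ.* + 3))
    (trans (cong (λ x → (+ 2 ℤ.+ x) ℤ.* (+ 2 ℤ.+ x) ℤ.- + 1) (ℤ.pos-* n 3)) (eq (+ n)))))
    where
    eq : ∀ n → (+ 2 ℤ.+ n ℤ.* + 3) ℤ.* (+ 2 ℤ.+ n ℤ.* + 3) ℤ.- + 1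
             ≡ (+ 1 ℤ.+ n ℤ.* (+ 4 ℤ.+ n ℤ.* + 3)) ℤ.* + 3
    eq = solve-∀

∣3^-≤ : ∀ {k e f} → e ℕ.≤ f → k ∣3^ e → k ∣3^ f
∣3^-≤ e≤f = go (ℕ.≤⇒≤′ e≤f)
  where
  go : ∀ {k e f} → e ℕ.≤′ f → k ∣3^ e → k ∣3^ f
  go ℕ.≤′-refl      p = p
  go (ℕ.≤′-step e≤f) p = ∣3^-suc (go e≤f p)

coprimePart : ℕ → ℕ
coprimePart zero    = 1
coprimePart (suc n) = (2 ℕ.+ n ℕ.* 3) ℕ.* (1 ℕ.+ n ℕ.* 3) ℕ.* coprimePart n

[3n]! : ∀ n → (n ℕ.* 3) ! ≡ 3 ℕ.^ n ℕ.* coprimePart n ℕ.* n !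
[3n]! zero    = refl
[3n]! (suc n) = trans
  (cong (λ f → (3 ℕ.+ n ℕ.* 3) ℕ.* ((2 ℕ.+ n ℕ.* 3) ℕ.* ((1 ℕ.+ n ℕ.* 3) ℕ.* f))) ([3n]! n))
  (eq n (3 ℕ.^ n) (coprimePart n) (n !))
  where
  eq : ∀ n p c f →
       (3 ℕ.+ n ℕ.* 3) ℕ.* ((2 ℕ.+ n ℕ.* 3) ℕ.* ((1 ℕ.+ n ℕ.* 3) ℕ.* (p ℕ.* c ℕ.* f)))
       ≡ 3 ℕ.* p ℕ.* ((2 ℕ.+ n ℕ.* 3) ℕ.* (1 ℕ.+ n ℕ.* 3) ℕ.* c) ℕ.* ((1 ℕ.+ n) ℕ.* f)
  eq = ℕ-solver.solve-∀

unit∣3^0 : ∀ k → Unit (fromℕ k) → k ∣3^ 0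
unit∣3^0 k u = mk∣ (proj₁ (inverse u)) (proj₂ (inverse u))

coprimePart∣3^0 : ∀ n → coprimePart n ∣3^ 0
coprimePart∣3^0 zero    = unit∣3^0 1 (3n+1-unit 0)
coprimePart∣3^0 (suc n) = ∣3^-* {e = 0} {0} (∣3^-* {e = 0} {0}
  (unit∣3^0 (2 ℕ.+ n ℕ.* 3) (3n+2-unit n)) (unit∣3^0 (1 ℕ.+ n ℕ.* 3) (3n+1-unit n))) (coprimePart∣3^0 n)

3^∣3^ : ∀ n → (3 ℕ.^ n) ∣3^ n
3^∣3^ zero    = unit∣3^0 1 (3n+1-unit 0)
3^∣3^ (suc n) = ∣3^-* {e = 1} {n} 3∣3^ (3^∣3^ n)

-- From n ≥ 1 on, both sides grow by 3 when n grows by 2; n = 2 is a base case because `pred`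
-- truncates at 0. The `+ 0` is the exponent contributed by `coprimePart`.
⌊3n-1/2⌋ : ∀ n → n ℕ.+ 0 ℕ.+ ⌊ ℕ.pred n /2⌋ ≡ ⌊ ℕ.pred (n ℕ.* 3) /2⌋
⌊3n-1/2⌋ 0 = refl
⌊3n-1/2⌋ 1 = refl
⌊3n-1/2⌋ 2 = refl
⌊3n-1/2⌋ (suc (suc n@(suc m))) =
  trans (ℕ.+-suc (suc (suc n) ℕ.+ 0) ⌊ m /2⌋) (cong (3 ℕ.+_) (⌊3n-1/2⌋ n))

-- Legendre: (3n)! is 3ⁿ n! up to a unit, so v₃(m!) ≤ (m-1)/2 by induction.
factorial∣3^ : ∀ m → (m !) ∣3^ ⌊ ℕ.pred m /2⌋
factorial∣3^ = <-rec _ step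
  where
  [3n]!∣3^ : ∀ n → (n !) ∣3^ ⌊ ℕ.pred n /2⌋ → ((n ℕ.* 3) !) ∣3^ ⌊ ℕ.pred (n ℕ.* 3) /2⌋
  [3n]!∣3^ n p = subst (((n ℕ.* 3) !) ∣3^_) (⌊3n-1/2⌋ n)
    (subst (_∣3^ (n ℕ.+ 0 ℕ.+ ⌊ ℕ.pred n /2⌋)) (sym ([3n]! n))
      (∣3^-* (∣3^-* (3^∣3^ n) (coprimePart∣3^0 n)) p))
  -- Going on from (3n)! to (3n+1)! and (3n+2)! multiplies by units, so the exponent only has to be
  -- relaxed.
  [3n+1]!∣3^ : ∀ n → (n !) ∣3^ ⌊ ℕ.pred n /2⌋ → ((1 ℕ.+ n ℕ.* 3) !) ∣3^ ⌊ n ℕ.* 3 /2⌋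
  [3n+1]!∣3^ n p = ∣3^-* {e = 0} (unit∣3^0 (1 ℕ.+ n ℕ.* 3) (3n+1-unit n))
    (∣3^-≤ (ℕ.⌊n/2⌋-mono ℕ.pred[n]≤n) ([3n]!∣3^ n p))
  step : ∀ m → (∀ {n} → n ℕ.< m → (n !) ∣3^ ⌊ ℕ.pred n /2⌋) → (m !) ∣3^ ⌊ ℕ.pred m /2⌋
  step m rec with m divMod 3
  step m rec | result zero      zero refl       = unit∣3^0 1 (3n+1-unit 0)
  step m rec | result (suc q-1) zero refl       = [3n]!∣3^ (suc q-1) (rec (ℕ.m<m*n (suc q-1) 3 (ℕ.s≤s (ℕ.s≤s ℕ.z≤n))))
  step m rec | result q         (suc zero) refl = [3n+1]!∣3^ q (rec (ℕ.s≤s (ℕ.m≤m*n q 3)))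
  step m rec | result q         (suc (suc zero)) refl =
    ∣3^-* {e = 0} (unit∣3^0 (2 ℕ.+ q ℕ.* 3) (3n+2-unit q))
      (∣3^-≤ (ℕ.⌊n/2⌋-mono (ℕ.n≤1+n (q ℕ.* 3))) ([3n+1]!∣3^ q (rec (ℕ.m<n⇒m<1+n (ℕ.s≤s (ℕ.m≤m*n q 3))))))

-- The series E

⊖⇒≈ : ∀ {x y} → x ⊖ y ≈ 0# → x ≈ y
⊖⇒≈ p = ≈[]⇒≈ λ n → ⊖⇒≈[] (≈⇒≈[] p)

≈⇒⊖ : ∀ {x y} → x ≈ y → x ⊖ y ≈ 0#
≈⇒⊖ p = ≈[]⇒≈ λ n → ≈[]⇒⊖ (≈⇒≈[] p)

⊗-zeroʳ-≈ : ∀ x {y} → y ≈ 0# → x ⊗ y ≈ 0#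
⊗-zeroʳ-≈ x p = ≈[]⇒≈ λ n → ⊗-zeroʳ x (≈⇒≈[] p)

-- Multiplying by the cofactor turns m! into a power of 3. Identities between the coefficients can
-- thus be checked after clearing denominators.
factorial-cancel : ∀ m {x} → fromℕ (m !) ⊗ x ≈ 0# → x ≈ 0#
factorial-cancel m {x} p = 3^-cancel ⌊ ℕ.pred m /2⌋
  (≈-trans (⊗-cong-≈ (≈-sym (equality m!∣)) ≈-refl)
    (≈-trans (rotate (fromℕ (m !)) (cofactor m!∣) x) (⊗-zeroʳ-≈ (cofactor m!∣) p)))
  where
  m!∣ : m ! ∣3^ ⌊ ℕ.pred m /2⌋
  m!∣ = factorial∣3^ m
  opaque
    unfolding _⊕_
    rotate : ∀ k d x → k ⊗ d ⊗ x ≈ d ⊗ (k ⊗ x)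
    rotate k d x = pointwise λ n → eq (residue k n) (residue d n) (residue x n)
      where
      eq : ∀ k d x → k ℤ.* d ℤ.* x ≡ d ℤ.* (k ℤ.* x)
      eq = solve-∀

3^≈0 : ∀ e → fromℤ (3^ e) ≈[ e ] 0#
3^≈0 e = mk≈[] (0-mod ℤ.∣-refl)

-- coeff j = 2·3ʲ/(j+2)!
coeff : ℕ → ℤ₃
coeff j = fromℕ 2 ⊗ cofactor (factorial∣3^ (2 ℕ.+ j)) ⊗ fromℤ (3^ ⌊ j /2⌋)

-- The third of `coeff (2 + j)`: the exponent ⌊(2+j)/2⌋ is lowered by one, so no division takes
-- place.
coeff/3 : ℕ → ℤ₃
coeff/3 j = fromℕ 2 ⊗ cofactor (factorial∣3^ (4 ℕ.+ j)) ⊗ fromℤ (3^ ⌊ j /2⌋)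

coeff≈3*coeff/3 : ∀ j → coeff (2 ℕ.+ j) ≈ three ⊗ coeff/3 j
coeff≈3*coeff/3 j = ≈-trans (⊗-cong-≈ ≈-refl (≈-sym (3^-⊗ 1 ⌊ j /2⌋)))
  (swap (fromℕ 2 ⊗ cofactor (factorial∣3^ (4 ℕ.+ j))) (fromℤ (3^ ⌊ j /2⌋)))
  where
  opaque
    unfolding _⊕_
    swap : ∀ x y → x ⊗ (three ⊗ y) ≈ three ⊗ (x ⊗ y)
    swap x y = pointwise λ n → eq (residue x n) (residue y n)
      where
      eq : ∀ x y → x ℤ.* (+ 3 ℤ.* y) ≡ + 3 ℤ.* (x ℤ.* y)
      eq = solve-∀

coeff≈0 : ∀ j → coeff j ≈[ ⌊ j /2⌋ ] 0#
coeff≈0 j = ⊗-zeroʳ _ (3^≈0 ⌊ j /2⌋)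

coeff/3≈0 : ∀ j → coeff/3 j ≈[ ⌊ j /2⌋ ] 0#
coeff/3≈0 j = ⊗-zeroʳ _ (3^≈0 ⌊ j /2⌋)

-- The cofactor stands for 3^⌈j/2⌉/(j+2)!, and ⌊j/2⌋ + ⌈j/2⌉ = j.
coeff-! : ∀ j → fromℕ ((2 ℕ.+ j) !) ⊗ coeff j ≈ fromℕ 2 ⊗ fromℤ (3^ j)
coeff-! j = ≈-trans (rotate (fromℕ ((2 ℕ.+ j) !)) (cofactor d) (fromℤ (3^ ⌊ j /2⌋)))
  (⊗-cong-≈ ≈-refl (≈-trans (⊗-cong-≈ ≈-refl (equality d))
    (≈-trans (3^-⊗ ⌊ j /2⌋ ⌈ j /2⌉)
      (subst (λ e → fromℤ (3^ (⌊ j /2⌋ ℕ.+ ⌈ j /2⌉)) ≈ fromℤ (3^ e)) (ℕ.⌊n/2⌋+⌈n/2⌉≡n j) ≈-refl))))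
  where
  d : (2 ℕ.+ j) ! ∣3^ ⌈ j /2⌉
  d = factorial∣3^ (2 ℕ.+ j)
  opaque
    unfolding _⊕_
    rotate : ∀ k d x → k ⊗ (fromℕ 2 ⊗ d ⊗ x) ≈ fromℕ 2 ⊗ (x ⊗ (k ⊗ d))
    rotate k d x = pointwise λ n → eq (residue k n) (residue d n) (residue x n)
      where
      eq : ∀ k d x → k ℤ.* (+ 2 ℤ.* d ℤ.* x) ≡ + 2 ℤ.* (x ℤ.* (k ℤ.* d))
      eq = solve-∀

-- After multiplication by (j+2)! both sides become 2·3ʲ⁺¹. Pascal's rule below needs the
-- coefficients only through this recursion and `coeff 0`.
coeff-suc : ∀ j → fromℕ (3 ℕ.+ j) ⊗ coeff (suc j) ≈ three ⊗ coeff j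
coeff-suc j = ⊖⇒≈ (factorial-cancel (2 ℕ.+ j)
  (≈-trans (expand (3 ℕ.+ j) ((2 ℕ.+ j) !) (coeff (suc j)) (coeff j))
    (≈⇒⊖ (≈-trans (coeff-! (suc j)) (≈-trans (shift j) (⊗-cong-≈ ≈-refl (≈-sym (coeff-! j))))))))
  where
  opaque
    unfolding _⊕_
    expand : ∀ k f x y → fromℕ f ⊗ (fromℕ k ⊗ x ⊖ three ⊗ y)
                         ≈ fromℕ (k ℕ.* f) ⊗ x ⊖ three ⊗ (fromℕ f ⊗ y)
    expand k f x y = pointwise λ n → trans (eq (+ k) (+ f) (residue x n) (residue y n))
      (cong (λ m → m ℤ.* residue x n ℤ.- + 3 ℤ.* (+ f ℤ.* residue y n)) (sym (ℤ.pos-* k f)))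
      where
      eq : ∀ k f x y → f ℤ.* (k ℤ.* x ℤ.- + 3 ℤ.* y) ≡ k ℤ.* f ℤ.* x ℤ.- + 3 ℤ.* (f ℤ.* y)
      eq = solve-∀
    shift : ∀ j → fromℕ 2 ⊗ fromℤ (3^ (suc j)) ≈ three ⊗ (fromℕ 2 ⊗ fromℤ (3^ j))
    shift j = pointwise λ n → trans (cong (+ 2 ℤ.*_) (ℤ.pos-* 3 (3 ℕ.^ j))) (eq (3^ j))
      where
      eq : ∀ x → + 2 ℤ.* (+ 3 ℤ.* x) ≡ + 3 ℤ.* (+ 2 ℤ.* x)
      eq = solve-∀

opaque
  unfolding _⊕_

  k⊗[x⊖1] : ∀ k x → k ⊗ (x ⊖ fromℕ 1) ≈ k ⊗ x ⊖ k
  k⊗[x⊖1] k x = pointwise λ n → eq (residue k n) (residue x n)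
    where
    eq : ∀ k x → k ℤ.* (x ℤ.- + 1) ≡ k ℤ.* x ℤ.- k
    eq = solve-∀

  2⊗3^0 : fromℕ 2 ⊗ fromℤ (3^ 0) ≈ fromℕ 2
  2⊗3^0 = pointwise λ n → refl

  2⊗3^1 : fromℕ 2 ⊗ fromℤ (3^ 1) ≈ fromℕ 6
  2⊗3^1 = pointwise λ n → refl

coeff-0 : coeff 0 ≈ fromℕ 1
coeff-0 = ⊖⇒≈ (factorial-cancel 2 (≈-trans (k⊗[x⊖1] (fromℕ 2) (coeff 0))
  (≈⇒⊖ (≈-trans (coeff-! 0) 2⊗3^0))))

coeff-1 : coeff 1 ≈ fromℕ 1
coeff-1 = ⊖⇒≈ (factorial-cancel 3 (≈-trans (k⊗[x⊖1] (fromℕ 6) (coeff 1))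
  (≈⇒⊖ (≈-trans (coeff-! 1) 2⊗3^1))))

sumTo : (ℕ → ℤ₃) → ℕ → ℤ₃
sumTo s zero    = 0#
sumTo s (suc n) = sumTo s n ⊕ s n

sumTo-cong : ∀ {n s s′} → (∀ j → s j ≈[ n ] s′ j) → ∀ N → sumTo s N ≈[ n ] sumTo s′ N
sumTo-cong p zero    = ≈[]-refl
sumTo-cong p (suc N) = ⊕-cong (sumTo-cong p N) (p N)

opaque
  unfolding _⊕_

  ⊕-identityʳ : ∀ x → x ⊕ 0# ≈ x
  ⊕-identityʳ x = pointwise λ n → ℤ.+-identityʳ (residue x n)

⊕-absorb : ∀ {n} x {y} → y ≈[ n ] 0# → x ⊕ y ≈[ n ] x
⊕-absorb x p = ≈[]-trans (⊕-cong ≈[]-refl p) (≈⇒≈[] (⊕-identityʳ x))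

⌊n*2/2⌋ : ∀ n → ⌊ n ℕ.* 2 /2⌋ ≡ n
⌊n*2/2⌋ zero    = refl
⌊n*2/2⌋ (suc n) = cong suc (⌊n*2/2⌋ n)

⌈n*2/2⌉ : ∀ n → ⌈ n ℕ.* 2 /2⌉ ≡ n
⌈n*2/2⌉ zero    = refl
⌈n*2/2⌉ (suc n) = cong suc (⌈n*2/2⌉ n)

-- A new digit is settled by every second term, hence partial sums of length 2n.
module Series (s : ℕ → ℤ₃) (s≈0 : ∀ j → s j ≈[ ⌊ j /2⌋ ] 0#) where

  partialSum : ℕ → ℤ₃
  partialSum n = sumTo s (n ℕ.* 2)

  cauchy : ∀ n → partialSum (suc n) ≈[ n ] partialSum n
  cauchy n = ≈[]-trans
    (⊕-absorb _ (subst (λ i → s (suc (n ℕ.* 2)) ≈[ i ] 0#) (⌈n*2/2⌉ n) (s≈0 (suc (n ℕ.* 2)))))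
    (⊕-absorb _ (subst (λ i → s (n ℕ.* 2) ≈[ i ] 0#) (⌊n*2/2⌋ n) (s≈0 (n ℕ.* 2))))

  total : ℤ₃
  total = limit partialSum cauchy

  total-≈[] : ∀ n → total ≈[ n ] sumTo s (n ℕ.* 2)
  total-≈[] = limit-≈[] partialSum cauchy

-- aʲ times the falling factorial t(t-1)⋯(t-j+1).
monomial : ℤ₃ → ℤ₃ → ℕ → ℤ₃
monomial t a zero    = fromℕ 1
monomial t a (suc j) = monomial t a j ⊗ (a ⊗ (t ⊖ fromℕ j))

monomial-cong : ∀ {n t t′ a a′} → t ≈[ n ] t′ → a ≈[ n ] a′ →
                ∀ j → monomial t a j ≈[ n ] monomial t′ a′ j
monomial-cong p q zero    = ≈[]-refl
monomial-cong p q (suc j) =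
  ⊗-cong (monomial-cong p q j) (⊗-cong q (⊖-cong p ≈[]-refl))

module Tail (t a : ℤ₃) = Series (λ j → monomial t a (2 ℕ.+ j) ⊗ coeff/3 j)
                               (λ j → ⊗-zeroʳ _ (coeff/3≈0 j))

opaque
  G : ℤ₃ → ℤ₃ → ℤ₃
  G t a = Tail.total t a

  G-≈[] : ∀ t a n →
    G t a ≈[ n ] sumTo (λ j → monomial t a (2 ℕ.+ j) ⊗ coeff/3 j) (n ℕ.* 2)
  G-≈[] = Tail.total-≈[]

G-cong : Congruent₂ G
G-cong {n} {t} {t′} {a} {a′} p q = ≈[]-trans (G-≈[] t a n) (≈[]-trans
  (sumTo-cong (λ j → ⊗-cong (monomial-cong p q (2 ℕ.+ j)) ≈[]-refl) (n ℕ.* 2))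
  (≈[]-sym (G-≈[] t′ a′ n)))

open Implicit G G-cong public using (E; E-cong)

partialE : ℤ₃ → ℤ₃ → ℕ → ℤ₃
partialE t a = sumTo (λ j → coeff j ⊗ monomial t a j)

partialE-split : ∀ t a N → partialE t a (2 ℕ.+ N) ≈
  fromℕ 1 ⊕ t ⊗ a ⊕ three ⊗ sumTo (λ j → monomial t a (2 ℕ.+ j) ⊗ coeff/3 j) N
partialE-split t a zero = ⊖⇒≈ (≈-trans (split t a (coeff 0) (coeff 1))
  (≈[]⇒≈ λ n → ⊕-0 (≈⇒≈[] (≈⇒⊖ coeff-0)) (⊗-zeroʳ _ (≈⇒≈[] (≈⇒⊖ coeff-1)))))
  where
  opaque
    unfolding _⊕_
    split : ∀ t a c c′ →
      (0# ⊕ c ⊗ fromℕ 1 ⊕ c′ ⊗ (fromℕ 1 ⊗ (a ⊗ (t ⊖ fromℕ 0)))) ⊖ (fromℕ 1 ⊕ t ⊗ a ⊕ three ⊗ 0#)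
      ≈ (c ⊖ fromℕ 1) ⊕ t ⊗ a ⊗ (c′ ⊖ fromℕ 1)
    split t a c c′ = pointwise λ n → eq (residue t n) (residue a n) (residue c n) (residue c′ n)
      where
      eq : ∀ t a c c′ →
        (+ 0 ℤ.+ c ℤ.* + 1 ℤ.+ c′ ℤ.* (+ 1 ℤ.* (a ℤ.* (t ℤ.- + 0)))) ℤ.- (+ 1 ℤ.+ t ℤ.* a ℤ.+ + 3 ℤ.* + 0)
        ≡ (c ℤ.- + 1) ℤ.+ t ℤ.* a ℤ.* (c′ ℤ.- + 1)
      eq = solve-∀
partialE-split t a (suc N) = ≈[]⇒≈ λ n → ≈[]-trans
  (⊕-cong (≈⇒≈[] (partialE-split t a N)) (⊗-cong (≈⇒≈[] (coeff≈3*coeff/3 N)) ≈[]-refl))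
  (≈⇒≈[] (regroup (fromℕ 1 ⊕ t ⊗ a) _ (coeff/3 N) (monomial t a (2 ℕ.+ N))))
  where
  opaque
    unfolding _⊕_
    regroup : ∀ x s c m → x ⊕ three ⊗ s ⊕ three ⊗ c ⊗ m ≈ x ⊕ three ⊗ (s ⊕ m ⊗ c)
    regroup x s c m = pointwise λ n → eq (residue x n) (residue s n) (residue c n) (residue m n)
      where
      eq : ∀ x s c m → x ℤ.+ + 3 ℤ.* s ℤ.+ + 3 ℤ.* c ℤ.* m ≡ x ℤ.+ + 3 ℤ.* (s ℤ.+ m ℤ.* c)
      eq = solve-∀

E-≈[] : ∀ t a n → E t a ≈[ n ] partialE t a (2 ℕ.+ n ℕ.* 2)
E-≈[] t a n = ≈[]-trans (⊕-cong ≈[]-refl (⊗-cong ≈[]-refl (G-≈[] t a n)))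
  (≈⇒≈[] (≈-sym (partialE-split t a (n ℕ.* 2))))

-- The binomial series of the geometric sum

module GeometricSum (a : ℤ₃) where

  -- aʲ times the falling factorial of z of length j + 2, so that `coeff j ⊗ term z j` is
  -- `2 (3a)^j binom(z, j+2)`.
  term : ℤ₃ → ℕ → ℤ₃
  term z zero    = z ⊗ (z ⊖ fromℕ 1)
  term z (suc j) = term z j ⊗ (a ⊗ (z ⊖ fromℕ (2 ℕ.+ j)))

  A : ℤ₃ → ℕ → ℤ₃
  A z = sumTo (λ j → coeff j ⊗ term z j)

  -- Twice the sum of `(3a)^(k-1) binom(z, k)` over 1 ≤ k ≤ N + 1, a truncation of 2((1+3a)^z -
  -- 1)/(3a).
  S : ℤ₃ → ℕ → ℤ₃
  S z N = fromℕ 2 ⊗ z ⊕ three ⊗ (a ⊗ A z N)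

  term-suc : ∀ z j → term (fromℕ 1 ⊕ z) (suc j) ≈ a ⊗ ((fromℕ 1 ⊕ z) ⊗ term z j)
  term-suc z zero = base z a
    where
    opaque
      unfolding _⊕_
      base : ∀ z a → let z′ = fromℕ 1 ⊕ z in
        z′ ⊗ (z′ ⊖ fromℕ 1) ⊗ (a ⊗ (z′ ⊖ fromℕ 2)) ≈ a ⊗ (z′ ⊗ (z ⊗ (z ⊖ fromℕ 1)))
      base z a = pointwise λ n → eq (residue z n) (residue a n)
        where
        eq : ∀ z a → (+ 1 ℤ.+ z) ℤ.* (+ 1 ℤ.+ z ℤ.- + 1) ℤ.* (a ℤ.* (+ 1 ℤ.+ z ℤ.- + 2))
                     ≡ a ℤ.* ((+ 1 ℤ.+ z) ℤ.* (z ℤ.* (z ℤ.- + 1)))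
        eq = solve-∀
  term-suc z (suc j) = ≈-trans (⊗-cong-≈ (term-suc z j) ≈-refl) (step z (term z j) j)
    where
    opaque
      unfolding _⊕_
      step : ∀ z b j → let z′ = fromℕ 1 ⊕ z in
        a ⊗ (z′ ⊗ b) ⊗ (a ⊗ (z′ ⊖ fromℕ (3 ℕ.+ j))) ≈ a ⊗ (z′ ⊗ (b ⊗ (a ⊗ (z ⊖ fromℕ (2 ℕ.+ j)))))
      step z b j = pointwise λ n → eq (residue z n) (residue a n) (residue b n) (+ j)
        where
        eq : ∀ z a b j → a ℤ.* ((+ 1 ℤ.+ z) ℤ.* b) ℤ.* (a ℤ.* (+ 1 ℤ.+ z ℤ.- (+ 3 ℤ.+ j)))
             ≡ a ℤ.* ((+ 1 ℤ.+ z) ℤ.* (b ℤ.* (a ℤ.* (z ℤ.- (+ 2 ℤ.+ j)))))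
        eq = solve-∀

  -- Pascal's rule; it turns the difference equation of S in z into that of 2ι_q,
  -- up to the last term of the truncated sum.
  A-suc : ∀ z N → A (fromℕ 1 ⊕ z) (suc N) ≈ A z (suc N) ⊕ S z N
  A-suc z zero = ⊖⇒≈ (≈-trans (base z a (coeff 0)) (⊗-zeroʳ-≈ _ (≈⇒⊖ coeff-0)))
    where
    opaque
      unfolding _⊕_
      base : ∀ z a c → let z′ = fromℕ 1 ⊕ z in
        (0# ⊕ c ⊗ (z′ ⊗ (z′ ⊖ fromℕ 1)))
        ⊖ (0# ⊕ c ⊗ (z ⊗ (z ⊖ fromℕ 1)) ⊕ (fromℕ 2 ⊗ z ⊕ three ⊗ (a ⊗ 0#)))
        ≈ fromℕ 2 ⊗ z ⊗ (c ⊖ fromℕ 1)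
      base z a c = pointwise λ n → eq (residue z n) (residue a n) (residue c n)
        where
        eq : ∀ z a c → (+ 0 ℤ.+ c ℤ.* ((+ 1 ℤ.+ z) ℤ.* (+ 1 ℤ.+ z ℤ.- + 1)))
          ℤ.- (+ 0 ℤ.+ c ℤ.* (z ℤ.* (z ℤ.- + 1)) ℤ.+ (+ 2 ℤ.* z ℤ.+ + 3 ℤ.* (a ℤ.* + 0)))
          ≡ + 2 ℤ.* z ℤ.* (c ℤ.- + 1)
        eq = solve-∀
  A-suc z (suc N) = ≈-trans
    (≈[]⇒≈ λ n → ⊕-cong (≈⇒≈[] (A-suc z N)) (⊗-cong ≈[]-refl (≈⇒≈[] (term-suc z N))))
    -- The two sides differ by a multiple of the recursion `coeff-suc` for index N.
    (⊖⇒≈ (≈-trans (step z (A z (suc N)) (A z N) (term z N) (coeff N) (coeff (suc N)) N)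
      (⊗-zeroʳ-≈ _ (≈⇒⊖ (coeff-suc N)))))
    where
    opaque
      unfolding _⊕_
      step : ∀ z A′ A b c c′ N →
        (A′ ⊕ (fromℕ 2 ⊗ z ⊕ three ⊗ (a ⊗ A)) ⊕ c′ ⊗ (a ⊗ ((fromℕ 1 ⊕ z) ⊗ b)))
        ⊖ (A′ ⊕ c′ ⊗ (b ⊗ (a ⊗ (z ⊖ fromℕ (2 ℕ.+ N)))) ⊕ (fromℕ 2 ⊗ z ⊕ three ⊗ (a ⊗ (A ⊕ c ⊗ b))))
        ≈ a ⊗ b ⊗ (fromℕ (3 ℕ.+ N) ⊗ c′ ⊖ three ⊗ c)
      step z A′ A b c c′ N = pointwise λ n → eq (residue z n) (residue a n) (residue A′ n)
        (residue A n) (residue b n) (residue c n) (residue c′ n) (+ N)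
        where
        eq : ∀ z a A′ A b c c′ N →
          (A′ ℤ.+ (+ 2 ℤ.* z ℤ.+ + 3 ℤ.* (a ℤ.* A)) ℤ.+ c′ ℤ.* (a ℤ.* ((+ 1 ℤ.+ z) ℤ.* b)))
          ℤ.- (A′ ℤ.+ c′ ℤ.* (b ℤ.* (a ℤ.* (z ℤ.- (+ 2 ℤ.+ N)))) ℤ.+ (+ 2 ℤ.* z ℤ.+ + 3 ℤ.* (a ℤ.* (A ℤ.+ c ℤ.* b))))
          ≡ a ℤ.* b ℤ.* ((+ 3 ℤ.+ N) ℤ.* c′ ℤ.- + 3 ℤ.* c)
        eq = solve-∀

  term≈monomial : ∀ z j → term z j ≈ z ⊗ (z ⊖ fromℕ 1) ⊗ monomial (z ⊖ fromℕ 2) a j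
  term≈monomial z zero = ⊗-one (z ⊗ (z ⊖ fromℕ 1))
    where
    opaque
      unfolding _⊕_
      ⊗-one : ∀ x → x ≈ x ⊗ fromℕ 1
      ⊗-one x = pointwise λ n → sym (ℤ.*-identityʳ (residue x n))
  term≈monomial z (suc j) = ≈-trans (⊗-cong-≈ (term≈monomial z j) ≈-refl)
    (step (z ⊗ (z ⊖ fromℕ 1)) (monomial (z ⊖ fromℕ 2) a j) z j)
    where
    opaque
      unfolding _⊕_
      step : ∀ x m z j → x ⊗ m ⊗ (a ⊗ (z ⊖ fromℕ (2 ℕ.+ j))) ≈ x ⊗ (m ⊗ (a ⊗ (z ⊖ fromℕ 2 ⊖ fromℕ j)))
      step x m z j = pointwise λ n → eq (residue a n) (residue x n) (residue m n) (residue z n) (+ j)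
        where
        eq : ∀ a x m z j → x ℤ.* m ℤ.* (a ℤ.* (z ℤ.- (+ 2 ℤ.+ j))) ≡ x ℤ.* (m ℤ.* (a ℤ.* (z ℤ.- + 2 ℤ.- j)))
        eq = solve-∀

  A≈partialE : ∀ z N → A z N ≈ z ⊗ (z ⊖ fromℕ 1) ⊗ partialE (z ⊖ fromℕ 2) a N
  A≈partialE z zero    = ≈-sym (⊗-zeroʳ-≈ _ ≈-refl)
  A≈partialE z (suc N) = ≈-trans
    (≈[]⇒≈ λ n → ⊕-cong (≈⇒≈[] (A≈partialE z N)) (⊗-cong ≈[]-refl (≈⇒≈[] (term≈monomial z N))))
    (collect (z ⊗ (z ⊖ fromℕ 1)) _ (coeff N) (monomial (z ⊖ fromℕ 2) a N))
    where
    opaque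
      unfolding _⊕_
      collect : ∀ x s c m → x ⊗ s ⊕ c ⊗ (x ⊗ m) ≈ x ⊗ (s ⊕ c ⊗ m)
      collect x s c m = pointwise λ n → eq (residue x n) (residue s n) (residue c n) (residue m n)
        where
        eq : ∀ x s c m → x ℤ.* s ℤ.+ c ℤ.* (x ℤ.* m) ≡ x ℤ.* (s ℤ.+ c ℤ.* m)
        eq = solve-∀

  module _ {q : ℤ₃} (q≈ : q ≈ fromℕ 1 ⊕ three ⊗ a) where

    opaque
      unfolding _⊕_

      -- The definition appends the highest power; splitting off the lowest one instead gives the
      -- form of the recursion of S.
      geometricSum-suc : ∀ m → geometricSum q (suc m) ≈ fromℕ 1 ⊕ q ⊗ geometricSum q m
      geometricSum-suc m = pointwise λ n → trans (residue-geo q (suc m) n)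
        (trans (geo-+ (residue q n) 1 m)
          (trans (eq (residue q n) (geo (residue q n) m))
            (cong (λ g → + 1 ℤ.+ residue q n ℤ.* g) (sym (residue-geo q m n)))))
        where
        eq : ∀ c g → (+ 0 ℤ.+ + 1) ℤ.+ c ℤ.* + 1 ℤ.* g ≡ + 1 ℤ.+ c ℤ.* g
        eq = solve-∀

      fromℕ-suc : ∀ m → fromℕ (suc m) ≈ fromℕ 1 ⊕ fromℕ m
      fromℕ-suc m = pointwise λ n → refl

    -- `fromℕ m` rebuilt with `fromℕ 1 ⊕_`, so that `A-suc` applies without rewriting its argument.
    successors : ℕ → ℤ₃
    successors zero    = 0#
    successors (suc m) = fromℕ 1 ⊕ successors m

    fromℕ≈successors : ∀ m → fromℕ m ≈ successors m
    fromℕ≈successors zero    = ≈-refl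
    fromℕ≈successors (suc m) = ≈-trans (fromℕ-suc m)
      (≈[]⇒≈ λ n → ⊕-cong ≈[]-refl (≈⇒≈[] (fromℕ≈successors m)))

    -- Both sides vanish at 0 and satisfy f(m+1) = 2 + q f(m); for S the recursion fails only by a
    -- multiple of `coeff N`, which is 0 modulo 3ⁿ.
    geometricSum-≈[]S : ∀ {n N} → coeff N ≈[ n ] 0# → ∀ m →
                        fromℕ 2 ⊗ geometricSum q m ≈[ n ] S (successors m) N
    geometricSum-≈[]S {n} {N} tail zero = ≈[]-sym (≈⇒≈[]
      (≈[]⇒≈ λ n → ≈[]-trans
        (⊕-cong ≈[]-refl (⊗-cong ≈[]-refl (⊗-cong ≈[]-refl (≈⇒≈[] (A≈partialE 0# N)))))
        (≈⇒≈[] (base (partialE (0# ⊖ fromℕ 2) a N)))))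
      where
      opaque
        unfolding _⊕_
        base : ∀ e → fromℕ 2 ⊗ 0# ⊕ three ⊗ (a ⊗ (0# ⊗ (0# ⊖ fromℕ 1) ⊗ e)) ≈ fromℕ 2 ⊗ 0#
        base e = pointwise λ n → eq (residue a n) (residue e n)
          where
          eq : ∀ a e → + 2 ℤ.* + 0 ℤ.+ + 3 ℤ.* (a ℤ.* (+ 0 ℤ.* (+ 0 ℤ.- + 1) ℤ.* e)) ≡ + 2 ℤ.* + 0
          eq = solve-∀
    geometricSum-≈[]S {n} {N} tail (suc m) = ≈[]-trans
      (⊗-cong ≈[]-refl (≈[]-trans (≈⇒≈[] (geometricSum-suc m)) (⊕-cong ≈[]-refl (⊗-cong (≈⇒≈[] q≈) ≈[]-refl))))
      (≈[]-trans (≈⇒≈[] (distribute a (geometricSum q m)))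
      (≈[]-trans (⊕-cong ≈[]-refl (⊗-cong ≈[]-refl (geometricSum-≈[]S {n} {N} tail m)))
      (≈[]-trans (≈⇒≈[] (regroup z a (A z N)))
      (⊕-cong ≈[]-refl (⊗-cong ≈[]-refl (⊗-cong ≈[]-refl
        (≈[]-sym (≈[]-trans (≈[]-sym (A-suc≈ (fromℕ 1 ⊕ z)))
          (≈[]-trans (≈⇒≈[] (A-suc z N)) (⊕-cong (A-suc≈ z) ≈[]-refl))))))))))
      where
      z : ℤ₃
      z = successors m
      A-suc≈ : ∀ z → A z (suc N) ≈[ n ] A z N
      A-suc≈ z = ⊕-absorb _ (≈[]-trans (⊗-cong tail ≈[]-refl) (≈⇒≈[] (0⊗ (term z N))))
        where
        opaque
          unfolding _⊕_
          0⊗ : ∀ x → 0# ⊗ x ≈ 0#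
          0⊗ x = pointwise λ n → refl
      opaque
        unfolding _⊕_
        distribute : ∀ a g → fromℕ 2 ⊗ (fromℕ 1 ⊕ (fromℕ 1 ⊕ three ⊗ a) ⊗ g)
                           ≈ fromℕ 2 ⊕ (fromℕ 1 ⊕ three ⊗ a) ⊗ (fromℕ 2 ⊗ g)
        distribute a g = pointwise λ n → eq (residue a n) (residue g n)
          where
          eq : ∀ a g → + 2 ℤ.* (+ 1 ℤ.+ (+ 1 ℤ.+ + 3 ℤ.* a) ℤ.* g)
                     ≡ + 2 ℤ.+ (+ 1 ℤ.+ + 3 ℤ.* a) ℤ.* (+ 2 ℤ.* g)
          eq = solve-∀
        regroup : ∀ z a A → let s = fromℕ 2 ⊗ z ⊕ three ⊗ (a ⊗ A) in
          fromℕ 2 ⊕ (fromℕ 1 ⊕ three ⊗ a) ⊗ s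
          ≈ fromℕ 2 ⊗ (fromℕ 1 ⊕ z) ⊕ three ⊗ (a ⊗ (A ⊕ s))
        regroup z a A = pointwise λ n → eq (residue z n) (residue a n) (residue A n)
          where
          eq : ∀ z a A →
            + 2 ℤ.+ (+ 1 ℤ.+ + 3 ℤ.* a) ℤ.* (+ 2 ℤ.* z ℤ.+ + 3 ℤ.* (a ℤ.* A))
            ≡ + 2 ℤ.* (+ 1 ℤ.+ z) ℤ.+ + 3 ℤ.* (a ℤ.* (A ℤ.+ (+ 2 ℤ.* z ℤ.+ + 3 ℤ.* (a ℤ.* A))))
          eq = solve-∀

    geometricSum-≈[]E : ∀ {n m z} → fromℕ m ≈[ n ] z → fromℕ 2 ⊗ geometricSum q m ≈[ n ]
      fromℕ 2 ⊗ z ⊕ three ⊗ (a ⊗ (z ⊗ (z ⊖ fromℕ 1) ⊗ E (z ⊖ fromℕ 2) a))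
    -- At length 2 + 2n the partial sum already is E modulo 3ⁿ, and the first omitted coefficient
    -- vanishes there.
    geometricSum-≈[]E {n} {m} {z} m≈z = ≈[]-trans (geometricSum-≈[]S {n} {2 ℕ.+ n ℕ.* 2} tail m)
      (⊕-cong (⊗-cong ≈[]-refl w≈z) (⊗-cong ≈[]-refl (⊗-cong ≈[]-refl
        (≈[]-trans (≈⇒≈[] (A≈partialE (successors m) (2 ℕ.+ n ℕ.* 2)))
          (⊗-cong (⊗-cong w≈z (⊖-cong w≈z ≈[]-refl))
            (≈[]-trans (≈[]-sym (E-≈[] _ a n)) (E-cong (⊖-cong w≈z ≈[]-refl) ≈[]-refl)))))))
      where
      w≈z : successors m ≈[ n ] z
      w≈z = ≈[]-trans (≈[]-sym (≈⇒≈[] (fromℕ≈successors m))) m≈z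
      tail : coeff (2 ℕ.+ n ℕ.* 2) ≈[ n ] 0#
      tail = lower n (subst (λ i → coeff (2 ℕ.+ n ℕ.* 2) ≈[ i ] 0#)
        (cong suc (⌊n*2/2⌋ n)) (coeff≈0 (2 ℕ.+ n ℕ.* 2)))

-- Modulo 3ⁿ, `ι q z` is by definition a geometric sum whose length is congruent to z, so the
-- formula for natural numbers carries over level by level.
ι-identity : ∀ {a} q → proj₁ q ≈ fromℕ 1 ⊕ three ⊗ a → ∀ z →
  fromℕ 2 ⊗ (ι q z ⊖ z) ≈ three ⊗ (a ⊗ (z ⊗ (z ⊖ fromℕ 1) ⊗ E (z ⊖ fromℕ 2) a))
ι-identity {a} q q≈ z = ≈[]⇒≈ λ n → ⊖⇒≈[] (≈[]-trans (≈⇒≈[] (move (ι q z) z _))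
  (≈[]⇒⊖ (≈[]-trans (⊗-cong ≈[]-refl (mk≈[] {ι q z} {n} {geometricSum (proj₁ q) (representative z n)} mod-refl))
    (GeometricSum.geometricSum-≈[]E a q≈ (mk≈[] (representative-≡ z n))))))
  where
  opaque
    unfolding _⊕_
    move : ∀ x z r → fromℕ 2 ⊗ (x ⊖ z) ⊖ r ≈ fromℕ 2 ⊗ x ⊖ (fromℕ 2 ⊗ z ⊕ r)
    move x z r = pointwise λ n → eq (residue x n) (residue z n) (residue r n)
      where
      eq : ∀ x z r → + 2 ℤ.* (x ℤ.- z) ℤ.- r ≡ + 2 ℤ.* x ℤ.- (+ 2 ℤ.* z ℤ.+ r)
      eq = solve-∀

-- Zero divisors and residue classes

infix 4 _≈[_]?_

_≈[_]?_ : ∀ x n y → Dec (x ≈[ n ] y)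
x ≈[ n ]? y = map′ (λ d → mk≈[] (mk≡ d)) (λ p → difference (level p))
  (3^ n ∣? (residue x n ℤ.- residue y n))

-- Every single level is decidable.
≈-stable : ∀ {x y} → ¬ ¬ x ≈ y → x ≈ y
≈-stable {x} {y} ¬¬p = ≈[]⇒≈ λ n →
  decidable-stable (x ≈[ n ]? y) λ ¬q → ¬¬p λ p → ¬q (≈⇒≈[] p)

data Class (x : ℤ₃) : Set where
  class0 : x ≈[ 1 ] fromℕ 0 → Class x
  class1 : x ≈[ 1 ] fromℕ 1 → Class x
  class2 : x ≈[ 1 ] fromℕ 2 → Class x

class : ∀ x → Class x
class x = go (representative x 1) (mk≈[] (mod-sym (representative-≡ x 1)))
             (ℤ.n%ℕd<d (residue x 1) 3)
  where
  go : ∀ r → x ≈[ 1 ] fromℕ r → r ℕ.< 3 → Class x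
  go 0 p _ = class0 p
  go 1 p _ = class1 p
  go 2 p _ = class2 p
  go (suc (suc (suc r))) p (ℕ.s≤s (ℕ.s≤s (ℕ.s≤s ())))

opaque
  unfolding _⊕_

  unit-1 : Unit (fromℕ 1)
  unit-1 = from-yes (fromℕ 1 ⊗ fromℕ 1 ≈[ 1 ]? fromℕ 1)

  unit-2 : Unit (fromℕ 2)
  unit-2 = from-yes (fromℕ 2 ⊗ fromℕ 2 ≈[ 1 ]? fromℕ 1)

  unit-0-2 : Unit (fromℕ 0 ⊖ fromℕ 2)
  unit-0-2 = from-yes ((fromℕ 0 ⊖ fromℕ 2) ⊗ (fromℕ 0 ⊖ fromℕ 2) ≈[ 1 ]? fromℕ 1)

  unit-1-2 : Unit (fromℕ 1 ⊖ fromℕ 2)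
  unit-1-2 = from-yes ((fromℕ 1 ⊖ fromℕ 2) ⊗ (fromℕ 1 ⊖ fromℕ 2) ≈[ 1 ]? fromℕ 1)

  three-cancel : ∀ n {x} → three ⊗ x ≈[ suc n ] 0# → x ≈[ n ] 0#
  three-cancel n {x} (mk≈[] p) = mk≈[] (mod-trans (mod-sym (coherent x n))
    (0-mod (ℤ.*-cancelˡ-∣ (+ 3) (subst (_∣ + 3 ℤ.* residue x (suc n)) (ℤ.pos-* 3 (3 ℕ.^ n)) (mod-0 p)))))

  multiple-of-three : ∀ {x} → x ≈[ 1 ] 0# → ∃[ y ] x ≈ three ⊗ y
  multiple-of-three {x} (mk≈[] p) = y , ≈-trans (proj₂ x∈3ℤ₃)
    (pointwise λ n → ℤ.+-identityˡ (+ 3 ℤ.* residue y n))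
    where
    x∈3ℤ₃ : x ∈ 0# +3^ 1 ℤ₃
    x∈3ℤ₃ = mod⇒coset 0# x 1 p
    y : ℤ₃
    y = proj₁ x∈3ℤ₃

unit-cong : ∀ {x y} → x ≈[ 1 ] y → Unit y → Unit x
unit-cong p u = ≈[]-trans (⊗-cong p p) u

unit≉0 : ∀ {x} → Unit x → ¬ x ≈[ 1 ] 0#
unit≉0 {x} u p = from-no (fromℕ 1 ≈[ 1 ]? fromℕ 0) (≈[]-trans (≈[]-sym u) (⊗-zeroʳ x p))

≉0⇒unit : ∀ {x} → ¬ x ≈[ 1 ] 0# → Unit x
≉0⇒unit {x} x≉0 = go (class x)
  where
  go : Class x → Unit x
  go (class0 p) = contradiction p x≉0
  go (class1 p) = unit-cong p unit-1
  go (class2 p) = unit-cong p unit-2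

lower-+ : ∀ m {n x y} → x ≈[ m ℕ.+ n ] y → x ≈[ n ] y
lower-+ zero    p = p
lower-+ (suc m) p = lower-+ m (lower _ p)

-- The quantitative form is needed because x ≉ 0# does not constructively
-- provide a level at which x is nonzero.
zero-product-≈[] : ∀ m n {x y} → x ⊗ y ≈[ n ℕ.+ m ] 0# → ¬ x ≈[ n ] 0# → y ≈[ m ] 0#
zero-product-≈[] m zero    p x≉0 = contradiction ≈[0] x≉0
zero-product-≈[] m (suc n) {x} {y} p x≉0 with x ≈[ 1 ]? 0#
... | no  x≉0[1] = lower-+ (suc n) (unit-cancel (suc n ℕ.+ m) (≉0⇒unit x≉0[1]) p)
... | yes x≈0[1] = zero-product-≈[] m n
  (three-cancel (n ℕ.+ m) (≈[]-trans (≈⇒≈[] (assoc x′ y))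
    (≈[]-trans (⊗-cong (≈[]-sym (≈⇒≈[] x≈3x′)) ≈[]-refl) p)))
  (λ x′≈0 → x≉0 (≈[]-trans (≈⇒≈[] x≈3x′) (⊗-0-+ three≈0 x′≈0)))
  where
  x′ : ℤ₃
  x′ = proj₁ (multiple-of-three x≈0[1])
  x≈3x′ : x ≈ three ⊗ x′
  x≈3x′ = proj₂ (multiple-of-three x≈0[1])
  opaque
    unfolding _⊕_
    assoc : ∀ x y → three ⊗ (x ⊗ y) ≈ three ⊗ x ⊗ y
    assoc x y = pointwise λ n → sym (ℤ.*-assoc (+ 3) (residue x n) (residue y n))

-- If y were nonzero at some level m, the quantitative form would make x vanish at every level n.
zero-product : ∀ {x y} → x ⊗ y ≈ 0# → x ≉ 0# → y ≈ 0#
zero-product {x} {y} p x≉0 = ≈[]⇒≈ λ m → decidable-stable (y ≈[ m ]? 0#) λ y≉0 →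
  x≉0 (≈[]⇒≈ λ n → decidable-stable (x ≈[ n ]? 0#) λ x≉0[n] →
    y≉0 (zero-product-≈[] m n (≈⇒≈[] p) x≉0[n]))

-- The homeomorphism

module SolveA = Implicit G G-cong
module SolveT = Implicit (flip G) (flip G-cong)

opaque
  unfolding _⊕_

  E-flip : ∀ t a → SolveT.E a t ≈ E t a
  E-flip t a = pointwise λ n → cong (λ x → + 1 ℤ.+ x ℤ.+ + 3 ℤ.* residue (G t a) n)
    (ℤ.*-comm (residue a n) (residue t n))

  x⊖2⊕2 : ∀ x → x ⊕ fromℕ 2 ⊖ fromℕ 2 ≈ x
  x⊖2⊕2 x = pointwise λ n → eq (residue x n)
    where
    eq : ∀ x → x ℤ.+ + 2 ℤ.- + 2 ≡ x
    eq = solve-∀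

  ⊖-cancelʳ : ∀ {n x y} k → x ⊖ k ≈[ n ] y ⊖ k → x ≈[ n ] y
  ⊖-cancelʳ {n} {x} {y} k (mk≈[] (mk≡ p)) =
    mk≈[] (mod-by p (eq (residue x n) (residue y n) (residue k n)))
    where
    eq : ∀ x y k → (x ℤ.- k) ℤ.- (y ℤ.- k) ≡ x ℤ.- y
    eq = solve-∀

  ⊕-cancelˡ : ∀ {n x y} k → k ⊕ x ≈[ n ] k ⊕ y → x ≈[ n ] y
  ⊕-cancelˡ {n} {x} {y} k (mk≈[] (mk≡ p)) =
    mk≈[] (mod-by p (eq (residue x n) (residue y n) (residue k n)))
    where
    eq : ∀ x y k → (k ℤ.+ x) ℤ.- (k ℤ.+ y) ≡ x ℤ.- y
    eq = solve-∀

  three⊗-distrib-⊖ : ∀ x y → three ⊗ (x ⊖ y) ≈ three ⊗ x ⊖ three ⊗ y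
  three⊗-distrib-⊖ x y = pointwise λ n → eq (residue x n) (residue y n)
    where
    eq : ∀ x y → + 3 ℤ.* (x ℤ.- y) ≡ + 3 ℤ.* x ℤ.- + 3 ℤ.* y
    eq = solve-∀

three⊗-cancel : ∀ {n x y} → three ⊗ x ≈[ suc n ] three ⊗ y → x ≈[ n ] y
three⊗-cancel {n} {x} {y} p = ⊖⇒≈[] (three-cancel n
  (≈[]-trans (≈⇒≈[] (three⊗-distrib-⊖ x y)) (≈[]⇒⊖ p)))

three⊗-cong : ∀ {n x y} → x ≈[ n ] y → three ⊗ x ≈[ suc n ] three ⊗ y
three⊗-cong {n} {x} {y} p = ⊖⇒≈[]
  (≈[]-trans (≈[]-sym (≈⇒≈[] (three⊗-distrib-⊖ x y))) (⊗-0-+ three≈0 (≈[]⇒⊖ p)))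

q⟨_⟩ : ℤ₃ → ℤ₃
q⟨ a ⟩ = fromℕ 1 ⊕ three ⊗ a

-- The factor 3 shifts levels by one: conditions on q modulo 9 are conditions on a modulo 3.
q-cong : ∀ {n a a′} → a ≈[ n ] a′ → q⟨ a ⟩ ≈[ suc n ] q⟨ a′ ⟩
q-cong p = ⊕-cong ≈[]-refl (three⊗-cong p)

q-cancel : ∀ {n a a′} → q⟨ a ⟩ ≈[ suc n ] q⟨ a′ ⟩ → a ≈[ n ] a′
q-cancel p = three⊗-cancel (⊕-cancelˡ (fromℕ 1) p)

opaque
  unfolding _⊕_

  -- `fromℤ (3^ 1)` reduces to `three`; only the opaque operations have to be unfolded.
  coset⇒q : ∀ {q a} → q ≈ 1# + fromℤ (3^ 1) * a → q ≈ q⟨ a ⟩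
  coset⇒q p = p

  q⇒coset : ∀ a → q⟨ a ⟩ ≈ 1# + fromℤ (3^ 1) * a
  q⇒coset a = ≈-refl

  q⟨fromℕ⟩ : ∀ s → q⟨ fromℕ s ⟩ ≈ fromℕ (1 ℕ.+ 3 ℕ.* s)
  q⟨fromℕ⟩ s = pointwise λ n → cong (λ x → + 1 ℤ.+ x) (sym (ℤ.pos-* 3 s))

Domain Range : Set
Domain = ∃ 3ℤ₃∪1+3ℤ₃
Range  = ∃ U⁽¹⁾∖U⁽²⁾

param : Range → ℤ₃
param q = proj₁ (proj₁ (proj₂ q))

param-q : ∀ q → proj₁ q ≈ q⟨ param q ⟩
param-q q = coset⇒q (proj₂ (proj₁ (proj₂ q)))

param-unit : ∀ q → Unit (param q)
param-unit q = ≉0⇒unit λ a≈0 → proj₂ (proj₂ q) (mod⇒coset 1# (proj₁ q) 2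
  (level (≈[]-trans (≈⇒≈[] (param-q q)) (≈[]-trans (q-cong a≈0) (≈⇒≈[] (q⟨fromℕ⟩ 0))))))

param-cong : ∀ {n} q q′ → proj₁ q ≈[ suc n ] proj₁ q′ → param q ≈[ n ] param q′
param-cong q q′ p = q-cancel (≈[]-trans (≈[]-sym (≈⇒≈[] (param-q q)))
  (≈[]-trans p (≈⇒≈[] (param-q q′))))

range : ∀ a → Unit a → Range
range a u = q⟨ a ⟩ , (a , q⇒coset a) , λ q∈U⁽²⁾ → unit≉0 u
  (q-cancel (≈[]-trans (mk≈[] (coset⇒mod 1# q⟨ a ⟩ 2 q∈U⁽²⁾)) (≈[]-sym (≈⇒≈[] (q⟨fromℕ⟩ 0)))))

-- The domain omits exactly the class of 2 modulo 3.
domain-unit : (z : Domain) → Unit (proj₁ z ⊖ fromℕ 2)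
domain-unit (z , inj₁ z∈) = unit-cong (⊖-cong (mk≈[] (coset⇒mod 0# z 1 z∈)) ≈[]-refl) unit-0-2
domain-unit (z , inj₂ z∈) = unit-cong (⊖-cong (mk≈[] (coset⇒mod 1# z 1 z∈)) ≈[]-refl) unit-1-2

unit⇒domain : ∀ z → Unit (z ⊖ fromℕ 2) → z ∈ 3ℤ₃∪1+3ℤ₃
unit⇒domain z u = go (class z)
  where
  go : Class z → z ∈ 3ℤ₃∪1+3ℤ₃
  go (class0 p) = inj₁ (mod⇒coset 0# z 1 (level p))
  go (class1 p) = inj₂ (mod⇒coset 1# z 1 (level p))
  go (class2 p) = contradiction (≈[]⇒⊖ p) (unit≉0 u)

Root : ℕ → ℤ₃ → ℤ₃ → Set
Root n z a = E (z ⊖ fromℕ 2) a ≈[ n ] 0#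

root-unique-a : ∀ n {z z′ a a′} → Unit (z ⊖ fromℕ 2) → z ≈[ n ] z′ →
                Root n z a → Root n z′ a′ → a ≈[ n ] a′
root-unique-a n u p r r′ = SolveA.root-unique n u (⊖-cong p ≈[]-refl) r r′

root-unique-z : ∀ n {z z′ a a′} → Unit a → a ≈[ n ] a′ →
                Root n z a → Root n z′ a′ → z ≈[ n ] z′
root-unique-z n u p r r′ = ⊖-cancelʳ (fromℕ 2) (SolveT.root-unique n u p
  (≈[]-trans (≈⇒≈[] (E-flip _ _)) r) (≈[]-trans (≈⇒≈[] (E-flip _ _)) r′))

opaque
  Ψ-param : Domain → ℤ₃
  Ψ-param z = SolveA.root (domain-unit z)

  Ψ-param-root : ∀ z n → Root n (proj₁ z) (Ψ-param z)
  Ψ-param-root z n = ≈⇒≈[] (SolveA.root-isRoot (domain-unit z))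

  Ψ⁻¹ : Range → ℤ₃
  Ψ⁻¹ q = SolveT.root (param-unit q) ⊕ fromℕ 2

  Ψ⁻¹-root : ∀ q n → Root n (Ψ⁻¹ q) (param q)
  Ψ⁻¹-root q n = ≈[]-trans (E-cong (≈⇒≈[] (x⊖2⊕2 _)) ≈[]-refl)
    (≈[]-trans (≈[]-sym (≈⇒≈[] (E-flip _ _))) (≈⇒≈[] (SolveT.root-isRoot (param-unit q))))

  Ψ⁻¹-unit : ∀ q → Unit (Ψ⁻¹ q ⊖ fromℕ 2)
  Ψ⁻¹-unit q = unit-cong (≈⇒≈[] (x⊖2⊕2 _))
    (SolveT.root-unit (param-unit q) (≈⇒≈[] (SolveT.root-isRoot (param-unit q))))

Ψ-to : Domain → Range
Ψ-to z = range (Ψ-param z) (SolveA.root-unit (domain-unit z) (Ψ-param-root z 1))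

Ψ-from : Range → Domain
Ψ-from q = Ψ⁻¹ q , unit⇒domain (Ψ⁻¹ q) (Ψ⁻¹-unit q)

to-lipschitz : ∀ n z z′ → proj₁ z ≈[ n ] proj₁ z′ → proj₁ (Ψ-to z) ≈[ suc n ] proj₁ (Ψ-to z′)
to-lipschitz n z z′ p = q-cong (root-unique-a n (domain-unit z) p (Ψ-param-root z n) (Ψ-param-root z′ n))

from-lipschitz : ∀ n q q′ → proj₁ q ≈[ suc n ] proj₁ q′ → Ψ⁻¹ q ≈[ n ] Ψ⁻¹ q′
from-lipschitz n q q′ p = root-unique-z n (param-unit q) (param-cong q q′ p) (Ψ⁻¹-root q n) (Ψ⁻¹-root q′ n)

to∘from : ∀ q z → proj₁ z ≈ Ψ⁻¹ q → Ψ-to z ≈′ q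
to∘from q z p = ≈-trans (≈[]⇒≈ λ n → lower n (q-cong
    (root-unique-a n (domain-unit z) (≈⇒≈[] p) (Ψ-param-root z n) (Ψ⁻¹-root q n))))
  (≈-sym (param-q q))

from∘to : ∀ z q → q ≈′ Ψ-to z → Ψ⁻¹ q ≈ proj₁ z
from∘to z q p = ≈[]⇒≈ λ n → root-unique-z n (param-unit q)
  (param-cong q (Ψ-to z) (≈⇒≈[] p)) (Ψ⁻¹-root q n) (Ψ-param-root z n)

Ψ : Homeomorphism 3ℤ₃∪1+3ℤ₃ U⁽¹⁾∖U⁽²⁾
Ψ = record
  { inverse = record
    { to        = Ψ-to
    ; from      = Ψ-from
    ; to-cong   = λ {z} {z′} p → ≈[]⇒≈ λ n → lower n (to-lipschitz n z z′ (≈⇒≈[] p))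
    ; from-cong = λ {q} {q′} p → ≈[]⇒≈ λ n → from-lipschitz n q q′ (≈⇒≈[] p)
    ; inverse   = (λ {q} {z} p → to∘from q z p) , (λ {z} {q} p → from∘to z q p)
    }
  ; to-continuous   = λ z n → n , λ w w∈ → mod⇒coset (proj₁ (Ψ-to z)) (proj₁ (Ψ-to w)) n
      (level (lower n (to-lipschitz n w z (mk≈[] (coset⇒mod (proj₁ z) (proj₁ w) n w∈)))))
  -- One more digit of q is needed, since q modulo 3ⁿ⁺¹ determines a only modulo 3ⁿ.
  ; from-continuous = λ q n → suc n , λ r r∈ → mod⇒coset (Ψ⁻¹ q) (Ψ⁻¹ r) n
      (level (from-lipschitz n r q (mk≈[] (coset⇒mod (proj₁ q) (proj₁ r) (suc n) r∈))))
  }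

-- Fixed points and the exceptional parameters

root⇒fixed : ∀ q z → (∀ n → Root n z (param q)) → IsFixedPoint q z
root⇒fixed q z r = ⊖⇒≈ (≈[]⇒≈ λ n → unit-cancel n unit-2
  (≈[]-trans (≈⇒≈[] (ι-identity (proj₁ q , proj₁ (proj₂ q)) (param-q q) z))
    (⊗-zeroʳ _ (⊗-zeroʳ _ (⊗-zeroʳ _ (r n))))))

-- In `ι-identity` the factors 3, a and z(z-1) are cancelled in turn; the last one is nonzero
-- because z is nontrivial.
fixed⇒root : ∀ q z → z ≉ 0# → z ≉ 1# → IsFixedPoint q z → ∀ n → Root n z (param q)
fixed⇒root q z z≉0 z≉1 fixed n = ≈⇒≈[] (zero-product
  (≈[]⇒≈ λ m → unit-cancel m (param-unit q) (≈⇒≈[] (3^-cancel 1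
    (≈-trans (≈-sym (ι-identity (proj₁ q , proj₁ (proj₂ q)) (param-q q) z))
      (⊗-zeroʳ-≈ _ (≈⇒⊖ fixed))))))
  λ z[z-1]≈0 → z≉1 (⊖⇒≈ (zero-product z[z-1]≈0 z≉0)))

to-unique : ∀ z → proj₁ z ≉ 0# → proj₁ z ≉ 1# → IsTheUnique (λ q → IsFixedPoint q (proj₁ z)) (Ψ-to z)
to-unique z z≉0 z≉1 = root⇒fixed (Ψ-to z) (proj₁ z) (Ψ-param-root z) , λ {q′} fixed →
  ≈-trans (≈[]⇒≈ λ n → lower n (q-cong (root-unique-a n (domain-unit z) ≈[]-refl
      (Ψ-param-root z n) (fixed⇒root q′ (proj₁ z) z≉0 z≉1 fixed n))))
    (≈-sym (param-q q′))

-- Here b is the trivial point 0 or 1, and s is the class of a modulo 3 forced by `root-mod-3`: s =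
-- 2 gives q ≡ 7 and s = 1 gives q ≡ 4 modulo 9. The last two hypotheses say that b is trivial and
-- is the only trivial point in its class modulo 3.
module Exceptional (b : Domain) (s : ℕ)
  (root-mod-3  : fromℕ 1 ⊕ (proj₁ b ⊖ fromℕ 2) ⊗ fromℕ s ≈[ 1 ] 0#)
  (trivial     : ∀ {z} → z ≈ proj₁ b → z ≉ 0# → z ≉ 1# → ∀ {A : Set} → A)
  (nontrivial  : ∀ {z} → z ≈[ 1 ] proj₁ b → z ≉ proj₁ b → z ≉ 0# × z ≉ 1#)
  where

  root-s : Root 1 (proj₁ b) (fromℕ s)
  root-s = ⊕-0 root-mod-3 (⊗-0-+ {n = 0} three≈0 ≈[0])

  -- A nontrivial fixed point for Ψ(b) would be a root, hence b itself. Conversely, the class of q′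
  -- modulo 9 puts the fixed point `Ψ⁻¹ q′` into the class of b modulo 3; being trivial, it is b.
  exceptional : IsTheUnique (ExceptionalMod9 (1 ℕ.+ 3 ℕ.* s)) (Ψ-to b)
  exceptional =
    ( mod⇒coset (fromℕ (1 ℕ.+ 3 ℕ.* s)) (proj₁ (Ψ-to b)) 2
        (level (≈[]-trans (q-cong (root-unique-a 1 (domain-unit b) ≈[]-refl (Ψ-param-root b 1) root-s))
          (≈⇒≈[] (q⟨fromℕ⟩ s))))
    , λ (z , fixed , z≉0 , z≉1) → trivial
        (≈[]⇒≈ λ n → root-unique-z n (param-unit (Ψ-to b)) ≈[]-refl
          (fixed⇒root (Ψ-to b) z z≉0 z≉1 fixed n) (Ψ-param-root b n)) z≉0 z≉1
    -- The absence of nontrivial fixed points only refutes `Ψ⁻¹ q′ ≉ b`, so stability of equality is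
    -- required.
    ) , λ {q′} (q′∈ , none) → to∘from q′ b (≈-sym (≈-stable λ z≉b →
      none (Ψ⁻¹ q′ , root⇒fixed q′ (Ψ⁻¹ q′) (Ψ⁻¹-root q′) , nontrivial (z≈b[1] q′ q′∈) z≉b)))
    where
    z≈b[1] : ∀ q′ → proj₁ q′ ∈ fromℕ (1 ℕ.+ 3 ℕ.* s) +3^ 2 ℤ₃ → Ψ⁻¹ q′ ≈[ 1 ] proj₁ b
    z≈b[1] q′ q′∈ = root-unique-z 1 (param-unit q′)
      (q-cancel (≈[]-trans (≈[]-sym (≈⇒≈[] (param-q q′)))
        (≈[]-trans (mk≈[] (coset⇒mod (fromℕ (1 ℕ.+ 3 ℕ.* s)) (proj₁ q′) 2 q′∈)) (≈[]-sym (≈⇒≈[] (q⟨fromℕ⟩ s))))))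
      (Ψ⁻¹-root q′ 1) root-s

opaque
  unfolding _⊕_

  root-mod-3-0 : fromℕ 1 ⊕ (0# ⊖ fromℕ 2) ⊗ fromℕ 2 ≈[ 1 ] 0#
  root-mod-3-0 = from-yes (fromℕ 1 ⊕ (0# ⊖ fromℕ 2) ⊗ fromℕ 2 ≈[ 1 ]? 0#)

  root-mod-3-1 : fromℕ 1 ⊕ (1# ⊖ fromℕ 2) ⊗ fromℕ 1 ≈[ 1 ] 0#
  root-mod-3-1 = from-yes (fromℕ 1 ⊕ (1# ⊖ fromℕ 2) ⊗ fromℕ 1 ≈[ 1 ]? 0#)

module At0 = Exceptional zero∈ 2 root-mod-3-0
  (λ z≈0 z≉0 _ → ⊥-elim (z≉0 z≈0))
  (λ z≈0[1] z≉0 → z≉0 , λ z≈1 →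
    from-no (1# ≈[ 1 ]? 0#) (≈[]-trans (≈[]-sym (≈⇒≈[] z≈1)) z≈0[1]))

module At1 = Exceptional one∈ 1 root-mod-3-1
  (λ z≈1 _ z≉1 → ⊥-elim (z≉1 z≈1))
  (λ z≈1[1] z≉1 → (λ z≈0 →
    from-no (0# ≈[ 1 ]? 1#) (≈[]-trans (≈[]-sym (≈⇒≈[] z≈0)) z≈1[1])) , z≉1)

theorem6p1 : ∃[ q₀ ] ∃[ q₁ ]
    IsTheUnique (ExceptionalMod9 7) q₀ ×
    IsTheUnique (ExceptionalMod9 4) q₁ ×
    ∃ λ (Ψ : Homeomorphism 3ℤ₃∪1+3ℤ₃ U⁽¹⁾∖U⁽²⁾) →
    let open Homeomorphism Ψ using (to) in
    to zero∈ ≈′ q₀ ×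
    to one∈ ≈′ q₁ ×
    (∀ z → proj₁ z ≉ 0# → proj₁ z ≉ 1# →
    IsTheUnique (λ q → IsFixedPoint q (proj₁ z)) (to z))
theorem6p1 = Ψ-to zero∈ , Ψ-to one∈ , At0.exceptional , At1.exceptional ,
  Ψ , ≈-refl , ≈-refl , to-unique
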